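{- Consider the faulty-starter delivery problem described in the context, with finisher starting position $(x,y)$, $y\ge0$, and assume $(x,y)\notin D(1,1)$, i.e. $\sqrt{(x-1)^2+y^2}\ge 1$. Let $z_1=\sqrt{(x-1)^2+y^2}$ and $$t_1=\begin{cases}1-\dfrac{3y}{4} & \text{if } x=1,\\[2mm] \dfrac{x^2+y^2+z_1(1-x)-1-z_1\sqrt{x(x+z_1-2)+y^2-z_1+1}}{2(x-1)} & \text{otherwise.}\end{cases}$$ Then the competitive ratio of $\mathcal{A}_1$ equals $\mathrm{CR}_{\mathcal{A}_1}(\max\{t_1,0\})$, where $\mathrm{CR}_{\mathcal{A}_1}(t)=\dfrac{\sqrt{(x-1)^2+y^2}+2(1-t)}{\max\{1,\sqrt{(x-t)^2+y^2}+1-t\}}$.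
   Context: Setting. In the plane let $S=(0,0)$ and $T=(1,0)$. A "starter" drone carrying a package starts at $S$ at time $0$ and moves at unit speed along $\overline{ST}$ towards $T$. At an unknown time $t\in[0,1]$ it fails and stays forever at $(t,0)$ with the package. A "finisher" drone starts at time $0$ at $P=(x,y)$ with $y\ge0$, moves at unit speed and can stop and turn instantaneously. The package can be handed over only when the drones are co-located; it is delivered at the first time the finisher, carrying the package, is at $T$. An online algorithm $\mathcal{A}$ specifies the finisher's trajectory using only $(x,y)$; $A(t)$ is its delivery time for fail time $t$. $\mathrm{Opt}(t)=\max\{1,\sqrt{(x-t)^2+y^2}+1-t\}$ is the optimal offline delivery time. $\mathrm{CR}_{\mathcal{A}}(t)=A(t)/\mathrm{Opt}(t)$ and $\mathrm{CR}_{\mathcal{A}}=\sup_{0\le t\le1}\mathrm{CR}_{\mathcal{A}}(t)$. $D(c,r)$ denotes the open disk of radius $r$ centered at $(c,0)$. Algorithm $\mathcal{A}_1$: the finisher goes straight to $T$, then moves along the segment towards $S$ until it finds the package, then returns to $T$; its delivery time is $A_1(t)=\sqrt{(x-1)^2+y^2}+2(1-t)$. -}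

module Defs where

open import Data.Integer.Base using (+_; -[1+_])
import Data.Integer.Base as ℤ
import Data.Integer.Properties as ℤₚ
open import Data.Nat.Base using (ℕ; zero; suc)
import Data.Nat.Base as ℕ
import Data.Nat.Properties as ℕₚ
import Data.Nat.Coprimality as Coprimality
open import Data.Product.Base using (∃; _×_; _,_)
open import Data.Rational.Base using (ℚ; mkℚ; 0ℚ; 1ℚ; ½; ∣_∣) hiding (module ℚ)
import Data.Rational.Base as ℚ hiding (module ℚ)
import Data.Rational.Properties as ℚₚ
open import Data.Rational.Solver using (module +-*-Solver)
open import Data.Sum.Base using (_⊎_; inj₁; inj₂)
open import Relation.Binary.PropositionalEquality
open import Relation.Nullary using (yes; no; contradiction; ¬_)

-- Cauchy sequences of rationals, with an explicit modulus of convergence.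

IsCauchy : (ℕ → ℚ) → Set
IsCauchy s = ∀ ε → 0ℚ ℚ.< ε →
  ∃ λ N → ∀ m n → N ℕ.≤ m → N ℕ.≤ n → ∣ s m ℚ.- s n ∣ ℚ.< ε

record ℝ : Set where
  constructor mkℝ
  field
    seq    : ℕ → ℚ
    cauchy : IsCauchy seq

open ℝ public

-- 1/q, extended by 0 at q = 0.
recip : ℚ → ℚ
recip q with q ℚₚ.≟ 0ℚ
... | yes _   = 0ℚ
... | no q≢0 = (ℚ.1/ q) {{ℚ.≢-nonZero q≢0}}

½^ : ℕ → ℚ
½^ zero    = 1ℚ
½^ (suc n) = ½ ℚ.* ½^ n

-- Lower end of the interval obtained after n bisection steps for the square
-- root of q ≥ 0, starting from [0, 1+q]; its width is (1+q)/2ⁿ.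
sqrtWidth : ℚ → ℕ → ℚ
sqrtWidth q n = (1ℚ ℚ.+ q) ℚ.* ½^ n

sqrtLower : ℚ → ℕ → ℚ
sqrtLower q zero    = 0ℚ
sqrtLower q (suc n) with sqrtLower q n ℚ.+ sqrtWidth q (suc n)
... | s with s ℚ.* s ℚₚ.≤? q
...   | yes _ = s
...   | no  _ = sqrtLower q n

module RationalLemmas where
  open ℚ using (_+_; _*_; _-_; -_; _<_; _≤_; _⊔_)
  open ℚₚ
  open +-*-Solver using (solve; _:=_; _:+_; _:*_; _:-_; :-_; con)

  0<½ : 0ℚ < ½
  0<½ = positive⁻¹ ½

  0<1 : 0ℚ < 1ℚ
  0<1 = positive⁻¹ 1ℚ

  *-pos : ∀ {p q} → 0ℚ < p → 0ℚ < q → 0ℚ < p * q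
  *-pos {p} {q} 0<p 0<q =
    subst (_< p * q) (*-zeroˡ q) (*-monoˡ-<-pos q {{ℚ.positive 0<q}} 0<p)

  *-nonNeg : ∀ {p q} → 0ℚ ≤ p → 0ℚ ≤ q → 0ℚ ≤ p * q
  *-nonNeg {p} {q} 0≤p 0≤q =
    subst (_≤ p * q) (*-zeroˡ q) (*-monoʳ-≤-nonNeg q {{ℚ.nonNegative 0≤q}} 0≤p)

  *-mono-≤ : ∀ {a b c d} → 0ℚ ≤ a → 0ℚ ≤ d → a ≤ b → c ≤ d → a * c ≤ b * d
  *-mono-≤ {a} {b} {c} {d} 0≤a 0≤d a≤b c≤d =
    ≤-trans (*-monoˡ-≤-nonNeg a {{ℚ.nonNegative 0≤a}} c≤d)
            (*-monoʳ-≤-nonNeg d {{ℚ.nonNegative 0≤d}} a≤b)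

  half-pos : ∀ {ε} → 0ℚ < ε → 0ℚ < ½ * ε
  half-pos = *-pos 0<½

  halves : ∀ ε → ½ * ε + ½ * ε ≡ ε
  halves = solve 1 (λ e → con ½ :* e :+ con ½ :* e := e) refl

  p≤∣p∣ : ∀ p → p ≤ ∣ p ∣
  p≤∣p∣ p with ≤-total 0ℚ p
  ... | inj₁ 0≤p = ≤-reflexive (sym (0≤p⇒∣p∣≡p 0≤p))
  ... | inj₂ p≤0 = ≤-trans p≤0 (0≤∣p∣ p)

  ∣-∣-sym : ∀ p q → ∣ p - q ∣ ≡ ∣ q - p ∣
  ∣-∣-sym p q = trans (sym (∣-p∣≡∣p∣ (p - q)))
    (cong ∣_∣ (solve 2 (λ p q → :- (p :- q) := q :- p) refl p q))

  ∣-∣⇒< : ∀ p q {ε} → ∣ p - q ∣ < ε → p < q + ε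
  ∣-∣⇒< p q {ε} h =
    subst (_< q + ε) (solve 2 (λ p q → q :+ (p :- q) := p) refl p q)
      (+-monoʳ-< q (≤-<-trans (p≤∣p∣ (p - q)) h))

  <⇒-< : ∀ {p q ε} → p < q + ε → p - q < ε
  <⇒-< {p} {q} {ε} h =
    subst (p - q <_) (solve 2 (λ q e → (q :+ e) :- q := e) refl q ε)
      (+-monoˡ-< (- q) h)

  <⇒∣-∣ : ∀ p q {ε} → p < q + ε → q < p + ε → ∣ p - q ∣ < ε
  <⇒∣-∣ p q {ε} h k with ∣p∣≡p∨∣p∣≡-p (p - q)
  ... | inj₁ e = subst (_< ε) (sym e) (<⇒-< h)
  ... | inj₂ e = subst (_< ε)
    (sym (trans e (solve 2 (λ p q → :- (p :- q) := q :- p) refl p q))) (<⇒-< k)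

  ⊔-< : ∀ {a b c} → a < c → b < c → a ⊔ b < c
  ⊔-< {a} {b} {c} h k with ≤-total a b
  ... | inj₁ a≤b = subst (_< c) (sym (p≤q⇒p⊔q≡q a≤b)) k
  ... | inj₂ b≤a = subst (_< c) (sym (p≥q⇒p⊔q≡p b≤a)) h

  ⊔-<-+ : ∀ a b c d {ε} → a < c + ε → b < d + ε → a ⊔ b < (c ⊔ d) + ε
  ⊔-<-+ a b c d {ε} h k = ⊔-<
    (<-≤-trans h (+-monoˡ-≤ ε (p≤p⊔q c d)))
    (<-≤-trans k (+-monoˡ-≤ ε (p≤q⊔p c d)))

  recip-inverseʳ : ∀ {q} → q ≢ 0ℚ → q * recip q ≡ 1ℚ
  recip-inverseʳ {q} q≢0 with q ≟ 0ℚ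
  ... | yes q≡0 = contradiction q≡0 q≢0
  ... | no  nz  = *-inverseʳ q {{ℚ.≢-nonZero nz}}

  recip-pos : ∀ {q} → 0ℚ < q → 0ℚ < recip q
  recip-pos {q} 0<q with recip q ≤? 0ℚ
  ... | no  r≰0 = ≰⇒> r≰0
  ... | yes r≤0 = contradiction 1≤0 (λ h → <-irrefl refl (<-≤-trans 0<1 h))
    where
    1≤0 : 1ℚ ≤ 0ℚ
    1≤0 = subst₂ _≤_ (recip-inverseʳ (λ e → <⇒≢ 0<q (sym e))) (*-zeroʳ q)
      (*-monoˡ-≤-nonNeg q {{ℚ.nonNegative (<⇒≤ 0<q)}} r≤0)

  0<∣p∣⇒p≢0 : ∀ {δ p} → 0ℚ < δ → δ < ∣ p ∣ → p ≢ 0ℚ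
  0<∣p∣⇒p≢0 0<δ δ<∣p∣ refl = <-asym 0<δ δ<∣p∣

  product-< : ∀ {p q B δ} → 0ℚ < δ → ∣ p ∣ < B → ∣ q ∣ < δ → ∣ p * q ∣ < B * δ
  product-< {p} {q} {B} {δ} 0<δ hp hq =
    subst (_< B * δ) (sym (∣p*q∣≡∣p∣*∣q∣ p q))
      (≤-<-trans (*-monoˡ-≤-nonNeg ∣ p ∣ {{∣-∣-nonNeg p}} (<⇒≤ hq))
                 (*-monoˡ-<-pos δ {{ℚ.positive 0<δ}} hp))

  recip-cancel : ∀ C h → 0ℚ < C → C * (h * recip C) ≡ h
  recip-cancel C h 0<C = trans
    (solve 3 (λ c h r → c :* (h :* r) := h :* (c :* r)) refl C h (recip C))
    (trans (cong (h *_) (recip-inverseʳ (λ e → <⇒≢ 0<C (sym e)))) (*-identityʳ h))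

  product-close : ∀ p q r s {A B ε} → 0ℚ < ε → 0ℚ < A → 0ℚ < B →
    ∣ p ∣ < A → ∣ s ∣ < B → ∣ p - r ∣ < ½ * ε * recip B → ∣ q - s ∣ < ½ * ε * recip A →
    ∣ p * q - r * s ∣ < ε
  product-close p q r s {A} {B} {ε} 0<ε 0<A 0<B hp hs hpr hqs =
    subst (λ v → ∣ v ∣ < ε) split
      (≤-<-trans (∣p+q∣≤∣p∣+∣q∣ (p * (q - s)) (s * (p - r)))
        (subst (∣ p * (q - s) ∣ + ∣ s * (p - r) ∣ <_) (halves ε) (+-mono-< left right)))
    where
    split : p * (q - s) + s * (p - r) ≡ p * q - r * s
    split = solve 4 (λ p q r s → p :* (q :- s) :+ s :* (p :- r) := p :* q :- r :* s) refl p q r s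
    left : ∣ p * (q - s) ∣ < ½ * ε
    left = subst (∣ p * (q - s) ∣ <_) (recip-cancel A (½ * ε) 0<A)
      (product-< {p} {q - s} (*-pos (half-pos 0<ε) (recip-pos 0<A)) hp hqs)
    right : ∣ s * (p - r) ∣ < ½ * ε
    right = subst (∣ s * (p - r) ∣ <_) (recip-cancel B (½ * ε) 0<B)
      (product-< {s} {p - r} (*-pos (half-pos 0<ε) (recip-pos 0<B)) hs hpr)

  recip-close : ∀ {p q δ ε} → 0ℚ < δ → 0ℚ < ε → δ < ∣ p ∣ → δ < ∣ q ∣ →
    ∣ p - q ∣ < ε * (δ * δ) → ∣ recip p - recip q ∣ < ε
  recip-close {p} {q} {δ} {ε} 0<δ 0<ε hp hq h =
    *-cancelʳ-<-nonNeg (∣ p ∣ * ∣ q ∣) {{ℚ.nonNegative (*-nonNeg (0≤∣p∣ p) (0≤∣p∣ q))}}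
      (subst (_< ε * (∣ p ∣ * ∣ q ∣)) (sym lhs) (<-≤-trans h bound))
    where
    rp = recip-inverseʳ (0<∣p∣⇒p≢0 0<δ hp)
    rq = recip-inverseʳ (0<∣p∣⇒p≢0 0<δ hq)
    inner : (recip p - recip q) * (p * q) ≡ q - p
    inner = trans
      (solve 4 (λ a b p q → (a :- b) :* (p :* q) := (p :* a) :* q :- (q :* b) :* p)
        refl (recip p) (recip q) p q)
      (trans (cong₂ (λ u v → u * q - v * p) rp rq)
        (cong₂ _-_ (*-identityˡ q) (*-identityˡ p)))
    lhs : ∣ recip p - recip q ∣ * (∣ p ∣ * ∣ q ∣) ≡ ∣ p - q ∣
    lhs = trans (cong (∣ recip p - recip q ∣ *_) (sym (∣p*q∣≡∣p∣*∣q∣ p q)))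
      (trans (sym (∣p*q∣≡∣p∣*∣q∣ (recip p - recip q) (p * q)))
        (trans (cong ∣_∣ inner) (∣-∣-sym q p)))
    bound : ε * (δ * δ) ≤ ε * (∣ p ∣ * ∣ q ∣)
    bound = *-monoˡ-≤-nonNeg ε {{ℚ.nonNegative (<⇒≤ 0<ε)}}
      (*-mono-≤ (<⇒≤ 0<δ) (0≤∣p∣ q) (<⇒≤ hp) (<⇒≤ hq))

  fromℕ : ℕ → ℚ
  fromℕ zero    = 0ℚ
  fromℕ (suc n) = 1ℚ + fromℕ n

  fromℕ-mkℚ : ∀ n → fromℕ n ≡ mkℚ (+ n) 0 (Coprimality.sym (Coprimality.1-coprimeTo n))
  fromℕ-mkℚ zero    = refl
  fromℕ-mkℚ (suc n) = trans (cong (λ k → 1ℚ + k) (fromℕ-mkℚ n))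
    (trans (/-cong {p₁ = + 1 ℤ.* + 1 ℤ.+ + n ℤ.* + 1} {p₂ = + suc n}
             (cong (λ k → + 1 ℤ.+ k) (ℤₚ.*-identityʳ (+ n))) refl)
      (normalize-coprime {suc n} {0} (Coprimality.sym (Coprimality.1-coprimeTo (suc n)))))

  fromℕ-mono : ∀ {m n} → m ℕ.≤ n → fromℕ m ≤ fromℕ n
  fromℕ-mono {n = zero}  ℕ.z≤n     = ≤-refl
  fromℕ-mono {n = suc n} ℕ.z≤n     = ≤-trans (fromℕ-mono {n = n} ℕ.z≤n)
    (subst (_≤ 1ℚ + fromℕ n) (+-identityˡ (fromℕ n)) (+-monoˡ-≤ (fromℕ n) (<⇒≤ 0<1)))
  fromℕ-mono (ℕ.s≤s m≤n) = +-monoʳ-≤ 1ℚ (fromℕ-mono m≤n)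

  archimedean : ∀ q → ∃ λ n → q ≤ fromℕ n
  archimedean q@(mkℚ a d c) = ℤ.∣ a ∣ , subst (q ≤_) (sym (fromℕ-mkℚ ℤ.∣ a ∣)) (ℚ.*≤* (le a))
    where
    le : ∀ a → a ℤ.* + 1 ℤ.≤ + ℤ.∣ a ∣ ℤ.* + suc d
    le (+ n)    = subst₂ ℤ._≤_ (sym (ℤₚ.*-identityʳ (+ n))) (ℤₚ.pos-* n (suc d))
      (ℤ.+≤+ (ℕₚ.m≤m*n n (suc d)))
    le -[1+ n ] = ℤ.-≤+

  ½^-pos : ∀ n → 0ℚ < ½^ n
  ½^-pos zero    = 0<1
  ½^-pos (suc n) = *-pos 0<½ (½^-pos n)

  ½^-bound : ∀ n → ½^ n * fromℕ (suc n) ≤ 1ℚ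
  ½^-bound zero    = ≤-refl
  ½^-bound (suc n) = ≤-trans
    (subst (½ * ½^ n * fromℕ (suc (suc n)) ≤_)
      (solve 2 (λ h k → con ½ :* h :* (con 1ℚ :+ (con 1ℚ :+ k))
                        :+ con ½ :* h :* k
                     := h :* (con 1ℚ :+ k)) refl (½^ n) (fromℕ n))
      (subst (_≤ ½ * ½^ n * fromℕ (suc (suc n)) + ½ * ½^ n * fromℕ n)
        (+-identityʳ _)
        (+-monoʳ-≤ (½ * ½^ n * fromℕ (suc (suc n)))
          (*-nonNeg (<⇒≤ (½^-pos (suc n))) (fromℕ-mono {n = n} ℕ.z≤n)))))
    (½^-bound n)

  ½^-small : ∀ B ε → 0ℚ < ε → ∃ λ N → ∀ n → N ℕ.≤ n → B * ½^ n < ε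
  ½^-small B ε 0<ε with archimedean (B * recip ε)
  ... | N , B/ε≤N = N , λ n N≤n →
    let h₁ : B ≤ ε * fromℕ n
        h₁ = subst (_≤ ε * fromℕ n)
          (trans (solve 3 (λ e b r → e :* (b :* r) := b :* (e :* r)) refl ε B (recip ε))
            (trans (cong (B *_) (recip-inverseʳ (λ e → <⇒≢ 0<ε (sym e)))) (*-identityʳ B)))
          (*-monoˡ-≤-nonNeg ε {{ℚ.nonNegative (<⇒≤ 0<ε)}}
            (≤-trans B/ε≤N (fromℕ-mono N≤n)))
        h₂ : B < ε * fromℕ (suc n)
        h₂ = ≤-<-trans h₁ (*-monoʳ-<-pos ε {{ℚ.positive 0<ε}}
          (subst (_< 1ℚ + fromℕ n) (+-identityˡ (fromℕ n)) (+-monoˡ-< (fromℕ n) 0<1)))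
        h₃ : B * ½^ n < ε * fromℕ (suc n) * ½^ n
        h₃ = *-monoˡ-<-pos (½^ n) {{ℚ.positive (½^-pos n)}} h₂
        h₄ : ε * fromℕ (suc n) * ½^ n ≤ ε
        h₄ = subst₂ _≤_
          (solve 3 (λ e k h → e :* (h :* k) := e :* k :* h) refl ε (fromℕ (suc n)) (½^ n))
          (*-identityʳ ε)
          (*-monoˡ-≤-nonNeg ε {{ℚ.nonNegative (<⇒≤ 0<ε)}} (½^-bound n))
    in <-≤-trans h₃ h₄

  sqrtWidth-nonNeg : ∀ {q} n → 0ℚ ≤ q → 0ℚ ≤ sqrtWidth q n
  sqrtWidth-nonNeg n 0≤q =
    *-nonNeg (+-mono-≤ (<⇒≤ 0<1) 0≤q) (<⇒≤ (½^-pos n))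

  sqrtWidth-halves : ∀ q n → sqrtWidth q (suc n) + sqrtWidth q (suc n) ≡ sqrtWidth q n
  sqrtWidth-halves q n =
    solve 2 (λ q h → (con 1ℚ :+ q) :* (con ½ :* h) :+ (con 1ℚ :+ q) :* (con ½ :* h)
                  := (con 1ℚ :+ q) :* h) refl q (½^ n)

  sq-mono : ∀ {a b} → 0ℚ ≤ a → a ≤ b → a * a ≤ b * b
  sq-mono 0≤a a≤b = *-mono-≤ 0≤a (≤-trans 0≤a a≤b) a≤b a≤b

  record SqrtBounds (q s w : ℚ) : Set where
    constructor bounds
    field
      nonNeg : 0ℚ ≤ s
      lower  : s * s ≤ q
      upper  : q < (s + w) * (s + w)

  sqrtLower-bounds : ∀ {q} → 0ℚ ≤ q → ∀ n → SqrtBounds q (sqrtLower q n) (sqrtWidth q n)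
  sqrtLower-bounds {q} 0≤q zero = bounds ≤-refl (subst (_≤ q) (sym (*-zeroˡ 0ℚ)) 0≤q)
    (subst (q <_)
      (solve 1 (λ q → q :+ (con 1ℚ :+ (q :+ q :* q))
                   := (con 0ℚ :+ (con 1ℚ :+ q) :* con 1ℚ) :* (con 0ℚ :+ (con 1ℚ :+ q) :* con 1ℚ))
        refl q)
      (subst (_< q + (1ℚ + (q + q * q))) (+-identityʳ q)
        (+-monoʳ-< q (+-mono-<-≤ 0<1 (+-mono-≤ 0≤q (*-nonNeg 0≤q 0≤q))))))
  sqrtLower-bounds {q} 0≤q (suc n)
    with sqrtLower-bounds 0≤q n
  ... | bounds 0≤s s²≤q q<
    with (sqrtLower q n + sqrtWidth q (suc n)) * (sqrtLower q n + sqrtWidth q (suc n)) ≤? q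
  ...   | yes s′²≤q = bounds (+-mono-≤ 0≤s (sqrtWidth-nonNeg (suc n) 0≤q)) s′²≤q
    (subst (λ u → q < u * u)
      (trans (cong (λ u → sqrtLower q n + u) (sym (sqrtWidth-halves q n)))
        (sym (+-assoc (sqrtLower q n) (sqrtWidth q (suc n)) (sqrtWidth q (suc n)))))
      q<)
  ...   | no  s′²≰q = bounds 0≤s s²≤q (≰⇒> s′²≰q)

  sqrt-close : ∀ {q q′ s s′ w w′ ε} → 0ℚ < ε → 0ℚ ≤ w′ → w′ < ε →
    SqrtBounds q s w → SqrtBounds q′ s′ w′ → q < q′ + ε * ε → s < s′ + (ε + ε)
  sqrt-close {q} {q′} {s} {s′} {w} {w′} {ε} 0<ε 0≤w′ w′<ε
    (bounds 0≤s s²≤q q<) (bounds 0≤s′ s′²≤q′ q′<) h with s <? s′ + (ε + ε)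
  ... | yes p = p
  ... | no  p = contradiction s²<s² (<-irrefl refl)
    where
    0≤ε = <⇒≤ 0<ε
    r = s′ + w′
    0≤r : 0ℚ ≤ r
    0≤r = +-mono-≤ 0≤s′ 0≤w′
    r+ε≤s : r + ε ≤ s
    r+ε≤s = ≤-trans
      (subst (r + ε ≤_) (+-assoc s′ ε ε) (+-monoˡ-≤ ε (+-monoʳ-≤ s′ (<⇒≤ w′<ε))))
      (≮⇒≥ p)
    expand : r * r + ε * ε ≤ (r + ε) * (r + ε)
    expand = subst₂ _≤_ (+-identityʳ (r * r + ε * ε))
      (solve 2 (λ r e → r :* r :+ e :* e :+ (r :* e :+ r :* e) := (r :+ e) :* (r :+ e)) refl r ε)
      (+-monoʳ-≤ (r * r + ε * ε) (+-mono-≤ (*-nonNeg 0≤r 0≤ε) (*-nonNeg 0≤r 0≤ε)))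
    s²<s² : s * s < s * s
    s²<s² = ≤-<-trans s²≤q (<-trans h (<-≤-trans (+-monoˡ-< (ε * ε) q′<)
      (≤-trans expand (sq-mono (+-mono-≤ 0≤r 0≤ε) r+ε≤s))))

-- The moduli are abstract: nothing depends on how they are chosen, and unfolding
-- them is slow.
module CauchyLemmas where
  open ℚ using (_+_; _*_; _-_; -_; _<_; _≤_; _⊔_)
  open ℚₚ
  open RationalLemmas
  open +-*-Solver using (solve; _:=_; _:+_; _:*_; _:-_; :-_; con)

  ⊔-ℕ : ∀ {a b n} → a ℕ.⊔ b ℕ.≤ n → (a ℕ.≤ n) × (b ℕ.≤ n)
  ⊔-ℕ {a} {b} h = ℕₚ.≤-trans (ℕₚ.m≤m⊔n a b) h , ℕₚ.≤-trans (ℕₚ.m≤n⊔m a b) h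

  Close : (ℕ → ℚ) → ℚ → Set
  Close s ε = ∃ λ N → ∀ m n → N ℕ.≤ m → N ℕ.≤ n → ∣ s m - s n ∣ < ε

  abstract
    const-cauchy : ∀ q → IsCauchy (λ _ → q)
    const-cauchy q ε 0<ε = 0 , λ _ _ _ _ →
      subst (λ u → ∣ u ∣ < ε) (sym (+-inverseʳ q)) 0<ε

  abstract
    +-cauchy : ∀ a b → IsCauchy a → IsCauchy b → IsCauchy (λ n → a n + b n)
    +-cauchy a b ca cb ε 0<ε with ca (½ * ε) (half-pos 0<ε) | cb (½ * ε) (half-pos 0<ε)
    ... | M , hM | N , hN = M ℕ.⊔ N , λ m n m≥ n≥ →
      let (mM , mN) = ⊔-ℕ {M} {N} m≥ ; (nM , nN) = ⊔-ℕ {M} {N} n≥ in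
      subst₂ (λ u v → ∣ u ∣ < v)
        (solve 4 (λ a b c d → (a :- c) :+ (b :- d) := (a :+ b) :- (c :+ d)) refl
          (a m) (b m) (a n) (b n))
        (halves ε)
        (≤-<-trans (∣p+q∣≤∣p∣+∣q∣ (a m - a n) (b m - b n))
          (+-mono-< (hM m n mM nM) (hN m n mN nN)))

  abstract
    neg-cauchy : ∀ a → IsCauchy a → IsCauchy (λ n → - a n)
    neg-cauchy a ca ε 0<ε with ca ε 0<ε
    ... | N , h = N , λ m n m≥ n≥ → subst (_< ε)
      (trans (sym (∣-p∣≡∣p∣ (a m - a n)))
        (cong ∣_∣ (neg-distrib-+ (a m) (- a n)))) (h m n m≥ n≥)

  abstract
    ⊔-cauchy : ∀ a b → IsCauchy a → IsCauchy b → IsCauchy (λ n → a n ⊔ b n)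
    ⊔-cauchy a b ca cb ε 0<ε with ca ε 0<ε | cb ε 0<ε
    ... | M , hM | N , hN = M ℕ.⊔ N , λ m n m≥ n≥ →
      let (mM , mN) = ⊔-ℕ {M} {N} m≥ ; (nM , nN) = ⊔-ℕ {M} {N} n≥ in
      <⇒∣-∣ (a m ⊔ b m) (a n ⊔ b n)
        (⊔-<-+ (a m) (b m) (a n) (b n)
          (∣-∣⇒< (a m) (a n) (hM m n mM nM)) (∣-∣⇒< (b m) (b n) (hN m n mN nN)))
        (⊔-<-+ (a n) (b n) (a m) (b m)
          (∣-∣⇒< (a n) (a m) (hM n m nM mM)) (∣-∣⇒< (b n) (b m) (hN n m nN mN)))

  Bounded : (ℕ → ℚ) → Set
  Bounded a = ∃ λ B → 0ℚ < B × ∃ λ N → ∀ n → N ℕ.≤ n → ∣ a n ∣ < B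

  bounded : ∀ a → IsCauchy a → Bounded a
  bounded a ca with ca 1ℚ 0<1
  ... | N , h = ∣ a N ∣ + 1ℚ , +-mono-≤-< (0≤∣p∣ (a N)) 0<1 , N , λ n n≥ →
    ≤-<-trans
      (subst (λ u → ∣ u ∣ ≤ ∣ a N ∣ + ∣ a n - a N ∣)
        (solve 2 (λ p q → q :+ (p :- q) := p) refl (a n) (a N))
        (∣p+q∣≤∣p∣+∣q∣ (a N) (a n - a N)))
      (+-monoʳ-< ∣ a N ∣ (h n N n≥ ℕₚ.≤-refl))

  abstract
    *-cauchy : ∀ a b → IsCauchy a → IsCauchy b → IsCauchy (λ n → a n * b n)
    *-cauchy a b ca cb ε 0<ε = go (bounded a ca) (bounded b cb)
      where
      go₂ : ∀ A B → 0ℚ < A → 0ℚ < B →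
        (∃ λ N → ∀ n → N ℕ.≤ n → ∣ a n ∣ < A) → (∃ λ N → ∀ n → N ℕ.≤ n → ∣ b n ∣ < B) →
        Close a (½ * ε * recip B) → Close b (½ * ε * recip A) →
        Close (λ n → a n * b n) ε
      go₂ A B 0<A 0<B (K , hK) (L , hL) (M , hM) (N , hN) =
        (K ℕ.⊔ L) ℕ.⊔ (M ℕ.⊔ N) , λ m n m≥ n≥ →
        let (mKL , mMN) = ⊔-ℕ {K ℕ.⊔ L} {M ℕ.⊔ N} m≥
            (nKL , nMN) = ⊔-ℕ {K ℕ.⊔ L} {M ℕ.⊔ N} n≥
            (mK , _) = ⊔-ℕ {K} {L} mKL
            (_ , nL) = ⊔-ℕ {K} {L} nKL
            (mM , mN) = ⊔-ℕ {M} {N} mMN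
            (nM , nN) = ⊔-ℕ {M} {N} nMN
        in product-close (a m) (b m) (a n) (b n) 0<ε 0<A 0<B
          (hK m mK) (hL n nL) (hM m n mM nM) (hN m n mN nN)
      go : Bounded a → Bounded b → Close (λ n → a n * b n) ε
      go (A , 0<A , hA) (B , 0<B , hB) = go₂ A B 0<A 0<B hA hB
        (ca (½ * ε * recip B) (*-pos {½ * ε} {recip B} (half-pos 0<ε) (recip-pos 0<B)))
        (cb (½ * ε * recip A) (*-pos {½ * ε} {recip A} (half-pos 0<ε) (recip-pos 0<A)))

  AwayFromZero : (ℕ → ℚ) → Set
  AwayFromZero a = ∃ λ δ → 0ℚ < δ × ∃ λ N → ∀ n → N ℕ.≤ n → δ < ∣ a n ∣

  abstract
    recip-cauchy : ∀ a → IsCauchy a → AwayFromZero a → IsCauchy (λ n → recip (a n))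
    recip-cauchy a ca (δ , 0<δ , M , hM) ε 0<ε with ca (ε * (δ * δ)) (*-pos 0<ε (*-pos 0<δ 0<δ))
    ... | N , hN = M ℕ.⊔ N , λ m n m≥ n≥ →
      let (mM , mN) = ⊔-ℕ {M} {N} m≥ ; (nM , nN) = ⊔-ℕ {M} {N} n≥ in
      recip-close {a m} {a n} 0<δ 0<ε (hM m mM) (hM n nM) (hN m n mN nN)

  abstract
    sqrt-cauchy : ∀ a → IsCauchy a → IsCauchy (λ n → sqrtLower (a n ⊔ 0ℚ) n)
    sqrt-cauchy a ca ε 0<ε = go (bounded q cq)
      where
      q : ℕ → ℚ
      q n = a n ⊔ 0ℚ
      cq : IsCauchy q
      cq = ⊔-cauchy a (λ _ → 0ℚ) ca (const-cauchy 0ℚ)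
      0≤q : ∀ n → 0ℚ ≤ q n
      0≤q n = p≤q⊔p (a n) 0ℚ
      η : ℚ
      η = ½ * ε
      0<η : 0ℚ < η
      0<η = half-pos 0<ε
      width : ∀ {B} n → ∣ q n ∣ < B → (1ℚ + B) * ½^ n < η → sqrtWidth (q n) n < η
      width n hB hη = ≤-<-trans
        (*-monoʳ-≤-nonNeg (½^ n) {{ℚ.nonNegative (<⇒≤ (½^-pos n))}}
          (+-monoʳ-≤ 1ℚ (≤-trans (p≤∣p∣ (q n)) (<⇒≤ hB))))
        hη
      half : ∀ m n → sqrtWidth (q n) n < η → ∣ q m - q n ∣ < η * η →
        sqrtLower (q m) m < sqrtLower (q n) n + ε
      half m n hw hq =
        subst (λ e → sqrtLower (q m) m < sqrtLower (q n) n + e) (halves ε)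
          (sqrt-close 0<η (sqrtWidth-nonNeg n (0≤q n)) hw
            (sqrtLower-bounds (0≤q m) m) (sqrtLower-bounds (0≤q n) n)
            (∣-∣⇒< (q m) (q n) hq))
      go₂ : ∀ B → (∃ λ N → ∀ n → N ℕ.≤ n → ∣ q n ∣ < B) → Close q (η * η) →
        (∃ λ N → ∀ n → N ℕ.≤ n → (1ℚ + B) * ½^ n < η) →
        Close (λ n → sqrtLower (q n) n) ε
      go₂ B (K , hK) (L , hL) (N , hN) = K ℕ.⊔ (L ℕ.⊔ N) , λ m n m≥ n≥ →
        let (mK , mLN) = ⊔-ℕ {K} {L ℕ.⊔ N} m≥
            (nK , nLN) = ⊔-ℕ {K} {L ℕ.⊔ N} n≥
            (mL , mN) = ⊔-ℕ {L} {N} mLN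
            (nL , nN) = ⊔-ℕ {L} {N} nLN
        in <⇒∣-∣ (sqrtLower (q m) m) (sqrtLower (q n) n)
          (half m n (width n (hK n nK) (hN n nN)) (hL m n mL nL))
          (half n m (width m (hK m mK) (hN m mN)) (hL n m nL mL))
      go : Bounded q → Close (λ n → sqrtLower (q n) n) ε
      go (B , _ , hB) = go₂ B hB (cq (η * η) (*-pos 0<η 0<η)) (½^-small (1ℚ + B) η 0<η)

open CauchyLemmas

infix  4 _≈_ _≤_ _<_ _#_
infixl 6 _+_ _-_ _⊔_
infixl 7 _*_ _÷_⟨_⟩
infix  8 -_ √_
infix  9 _²

_≈_ : ℝ → ℝ → Set
x ≈ y = ∀ ε → 0ℚ ℚ.< ε → ∃ λ N → ∀ n → N ℕ.≤ n → ∣ seq x n ℚ.- seq y n ∣ ℚ.< ε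

_≤_ : ℝ → ℝ → Set
x ≤ y = ∀ ε → 0ℚ ℚ.< ε → ∃ λ N → ∀ n → N ℕ.≤ n → seq x n ℚ.< seq y n ℚ.+ ε

_<_ : ℝ → ℝ → Set
x < y = ∃ λ ε → 0ℚ ℚ.< ε × ∃ λ N → ∀ n → N ℕ.≤ n → seq x n ℚ.+ ε ℚ.< seq y n

-- Apartness, the positive form of inequality; classically x # y iff x ≠ y.
_#_ : ℝ → ℝ → Set
x # y = x < y ⊎ y < x

fromℚ : ℚ → ℝ
fromℚ q = mkℝ (λ _ → q) (const-cauchy q)

0ℝ 1ℝ 2ℝ ¾ : ℝ
0ℝ = fromℚ 0ℚ
1ℝ = fromℚ 1ℚ
2ℝ = fromℚ (+ 2 ℚ./ 1)
¾  = fromℚ (+ 3 ℚ./ 4)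

_+_ : ℝ → ℝ → ℝ
x + y = mkℝ (λ n → seq x n ℚ.+ seq y n) (+-cauchy (seq x) (seq y) (cauchy x) (cauchy y))

-_ : ℝ → ℝ
- x = mkℝ (λ n → ℚ.- seq x n) (neg-cauchy (seq x) (cauchy x))

_-_ : ℝ → ℝ → ℝ
x - y = x + (- y)

_*_ : ℝ → ℝ → ℝ
x * y = mkℝ (λ n → seq x n ℚ.* seq y n) (*-cauchy (seq x) (seq y) (cauchy x) (cauchy y))

_⊔_ : ℝ → ℝ → ℝ
x ⊔ y = mkℝ (λ n → seq x n ℚ.⊔ seq y n) (⊔-cauchy (seq x) (seq y) (cauchy x) (cauchy y))

_² : ℝ → ℝ
x ² = x * x

-- √ (max {x , 0}), so the usual square root for x ≥ 0.
√_ : ℝ → ℝ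
√ x = mkℝ (λ n → sqrtLower (seq x n ℚ.⊔ 0ℚ) n) (sqrt-cauchy (seq x) (cauchy x))

#0⇒away : ∀ x → x # 0ℝ → AwayFromZero (seq x)
#0⇒away x (inj₁ (ε , 0<ε , N , h)) = ε , 0<ε , N , λ n n≥ →
  ℚₚ.<-≤-trans
    (subst₂ ℚ._<_
      (solve 2 (λ p e → (p :+ e) :+ (:- p) := e) refl (seq x n) ε)
      (ℚₚ.+-identityˡ (ℚ.- seq x n))
      (ℚₚ.+-monoˡ-< (ℚ.- seq x n) (h n n≥)))
    (subst (ℚ.- seq x n ℚ.≤_) (ℚₚ.∣-p∣≡∣p∣ (seq x n)) (RationalLemmas.p≤∣p∣ (ℚ.- seq x n)))
  where open +-*-Solver using (solve; _:=_; _:+_; :-_)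
#0⇒away x (inj₂ (ε , 0<ε , N , h)) = ε , 0<ε , N , λ n n≥ →
  ℚₚ.<-≤-trans (subst (ℚ._< seq x n) (ℚₚ.+-identityˡ ε) (h n n≥))
    (RationalLemmas.p≤∣p∣ (seq x n))

_÷_⟨_⟩ : (x y : ℝ) → y # 0ℝ → ℝ
x ÷ y ⟨ y#0 ⟩ = x * mkℝ (λ n → recip (seq y n)) (recip-cauchy (seq y) (cauchy y) (#0⇒away y y#0))

1⊔x#0 : ∀ x → 1ℝ ⊔ x # 0ℝ
1⊔x#0 x = inj₂ (½ , RationalLemmas.0<½ , 0 , λ n _ →
  ℚₚ.<-≤-trans (subst (ℚ._< 1ℚ) (sym (ℚₚ.+-identityˡ ½)) ½<1) (ℚₚ.p≤p⊔q 1ℚ (seq x n)))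
  where
  ½<1 : ½ ℚ.< 1ℚ
  ½<1 = subst (ℚ._< 1ℚ) (ℚₚ.+-identityʳ ½) (ℚₚ.+-monoʳ-< ½ RationalLemmas.0<½)

2[x-1]#0 : ∀ x → x # 1ℝ → 2ℝ * (x - 1ℝ) # 0ℝ
2[x-1]#0 x (inj₁ (ε , 0<ε , N , h)) =
  inj₁ (two ℚ.* ε , RationalLemmas.*-pos (ℚₚ.positive⁻¹ two) 0<ε , N , λ n n≥ →
    subst₂ ℚ._<_
      (solve 2 (λ p e → con two :* ((p :+ e) :- con 1ℚ) := con two :* (p :- con 1ℚ) :+ con two :* e)
        refl (seq x n) ε)
      refl
      (ℚₚ.*-monoʳ-<-pos two (ℚₚ.+-monoˡ-< (ℚ.- 1ℚ) (h n n≥))))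
  where
  open +-*-Solver using (solve; _:=_; _:+_; _:*_; _:-_; con)
  two = + 2 ℚ./ 1
2[x-1]#0 x (inj₂ (ε , 0<ε , N , h)) =
  inj₂ (two ℚ.* ε , RationalLemmas.*-pos (ℚₚ.positive⁻¹ two) 0<ε , N , λ n n≥ →
    subst (ℚ._< two ℚ.* (seq x n ℚ.- 1ℚ))
      (solve 1 (λ e → con two :* ((con 1ℚ :+ e) :- con 1ℚ) := con 0ℚ :+ con two :* e) refl ε)
      (ℚₚ.*-monoʳ-<-pos two (ℚₚ.+-monoˡ-< (ℚ.- 1ℚ) (h n n≥))))
  where
  open +-*-Solver using (solve; _:=_; _:+_; _:*_; _:-_; con)
  two = + 2 ℚ./ 1

IsSupremum : (ℝ → Set) → ℝ → Set
IsSupremum P s = (∀ v → P v → v ≤ s) × (∀ b → (∀ v → P v → v ≤ b) → s ≤ b)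

-- The delivery time of an algorithm, given the finisher's start (x , y) and
-- the fail time t.
DeliveryTime : Set
DeliveryTime = (x y t : ℝ) → ℝ

-- 1ℝ ⊔ _ is apart from 0ℝ by construction, which makes the division in CR total.
Opt : DeliveryTime
Opt x y t = 1ℝ ⊔ (√ ((x - t) ² + y ²) + 1ℝ - t)

CR : DeliveryTime → (x y t : ℝ) → ℝ
CR A x y t = A x y t ÷ Opt x y t ⟨ 1⊔x#0 (√ ((x - t) ² + y ²) + 1ℝ - t) ⟩

IsCompetitiveRatio : DeliveryTime → (x y : ℝ) → ℝ → Set
IsCompetitiveRatio A x y =
  IsSupremum (λ v → ∃ λ t → 0ℝ ≤ t × t ≤ 1ℝ × v ≈ CR A x y t)

z₁ : (x y : ℝ) → ℝ
z₁ x y = √ ((x - 1ℝ) ² + y ²)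

A₁ : DeliveryTime
A₁ x y t = z₁ x y + 2ℝ * (1ℝ - t)

t₁-x=1 : (x y : ℝ) → ℝ
t₁-x=1 x y = 1ℝ - ¾ * y

t₁-numerator : (x y : ℝ) → ℝ
t₁-numerator x y =
  x ² + y ² + z₁ x y * (1ℝ - x) - 1ℝ
    - z₁ x y * √ (x * (x + z₁ x y - 2ℝ) + y ² - z₁ x y + 1ℝ)

t₁-x≠1 : (x y : ℝ) → x # 1ℝ → ℝ
t₁-x≠1 x y x#1 = t₁-numerator x y ÷ (2ℝ * (x - 1ℝ)) ⟨ 2[x-1]#0 x x#1 ⟩

-- The case distinction x = 1 / x ≠ 1 is not decidable on ℝ, so t₁ is given by
-- its two defining equations, one per case, rather than as a function. Once the
-- case is known, t₁-exists provides it.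
record Is-t₁ (x y t₁ : ℝ) : Set where
  field
    x=1 : x ≈ 1ℝ → t₁ ≈ t₁-x=1 x y
    x≠1 : (x#1 : x # 1ℝ) → t₁ ≈ t₁-x≠1 x y x#1

≗⇒≈ : ∀ x y → (∀ n → seq x n ≡ seq y n) → x ≈ y
≗⇒≈ x y x≗y ε 0<ε = 0 , λ n _ → subst (λ u → ∣ u ∣ ℚ.< ε)
  (trans (sym (ℚₚ.+-inverseʳ (seq x n))) (cong (λ q → seq x n ℚ.- q) (x≗y n))) 0<ε

≈-refl : ∀ x → x ≈ x
≈-refl x = ≗⇒≈ x x (λ _ → refl)

≈⇒¬# : ∀ x y → x ≈ y → ¬ (x # y)
≈⇒¬# x y x≈y (inj₁ (ε , 0<ε , M , hM)) with x≈y ε 0<ε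
... | N , hN = ℚₚ.<-asym (hM n (ℕₚ.m≤m⊔n M N))
  (RationalLemmas.∣-∣⇒< (seq y n) (seq x n) (subst (ℚ._< ε) (RationalLemmas.∣-∣-sym (seq x n) (seq y n))
    (hN n (ℕₚ.m≤n⊔m M N))))
  where n = M ℕ.⊔ N
≈⇒¬# x y x≈y (inj₂ (ε , 0<ε , M , hM)) with x≈y ε 0<ε
... | N , hN = ℚₚ.<-asym (hM n (ℕₚ.m≤m⊔n M N)) (RationalLemmas.∣-∣⇒< (seq x n) (seq y n) (hN n (ℕₚ.m≤n⊔m M N)))
  where n = M ℕ.⊔ N

÷-irrelevant : ∀ x y (p q : y # 0ℝ) → x ÷ y ⟨ p ⟩ ≈ x ÷ y ⟨ q ⟩
÷-irrelevant x y p q = ≗⇒≈ (x ÷ y ⟨ p ⟩) (x ÷ y ⟨ q ⟩) (λ _ → refl)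

t₁-exists : ∀ x y → x ≈ 1ℝ ⊎ x # 1ℝ → ∃ (Is-t₁ x y)
t₁-exists x y (inj₁ x≈1) = t₁-x=1 x y , record
  { x=1 = λ _ → ≈-refl (t₁-x=1 x y)
  ; x≠1 = λ x#1 → contradiction x#1 (≈⇒¬# x 1ℝ x≈1)
  }
t₁-exists x y (inj₂ x#1) = t₁-x≠1 x y x#1 , record
  { x=1 = λ x≈1 → contradiction x#1 (≈⇒¬# x 1ℝ x≈1)
  ; x≠1 = λ x#1′ → ÷-irrelevant (t₁-numerator x y) (2ℝ * (x - 1ℝ)) (2[x-1]#0 x x#1) (2[x-1]#0 x x#1′)
  }

{-# OPTIONS --safe #-}

-- With u = x − 1, s = 1 − t and z = z₁ the triangle inequality gives
-- Opt = d + s, where d² = z² + 2us + s², so the ratio is (z + 2s)/(d + s).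
-- Put w = √(z² + zu). The ratio has the maximum z(2w + 3z)/(w + z)² over s ≥ 0,
-- attained at s₁ = z(w + 2z)/(2(w + z)), where d + s = w + z; the bound is, after
-- squaring, a perfect square times 2z² − w² ≥ 0. Both cases of the definition of
-- t₁ amount to 1 − t₁ = s₁. As d is convex in s, the ratio is quasi-concave, so
-- on [0, 1] it is maximal at min{s₁, 1} = 1 − max{t₁, 0}.
-- The order of ℝ is stable under double negation, hence inequalities may be
-- proved by the case distinctions x ≤ y or y < x.

module Submission where

open import Defs
open import Data.Integer.Base using (+_)
open import Data.Nat.Base using (ℕ)
import Data.Nat.Base as ℕ
import Data.Nat.Properties as ℕₚ
open import Data.Product.Base using (∃; _×_; _,_)
open import Data.Rational.Base using (ℚ; 0ℚ; 1ℚ; ½; ∣_∣)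
import Data.Rational.Base as ℚ
import Data.Rational.Properties as ℚₚ
open import Data.Rational.Solver using (module +-*-Solver)
open import Data.Sum.Base using (inj₁; inj₂)
open import Relation.Binary.PropositionalEquality using (_≡_; refl; sym; trans; cong; subst; subst₂)
open import Relation.Nullary using (¬_; yes; no; contradiction)
open +-*-Solver using (Polynomial; solve; _:=_; _:+_; _:*_; _:-_; :-_; con)
open RationalLemmas
open CauchyLemmas using (⊔-ℕ; Bounded; bounded; recip-cauchy)

infix 4 _≼_ _≺_ _≃_ _≗_

-- Wrappers: the relations of Defs unfold to Π-types, from which the related
-- reals cannot be inferred.
record _≼_ (x y : ℝ) : Set where
  constructor le
  field ≼⇒≤ : x ≤ y
open _≼_

record _≺_ (x y : ℝ) : Set where
  constructor lt
  field ≺⇒< : x < y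
open _≺_

record _≃_ (x y : ℝ) : Set where
  constructor antisym
  field
    ≃⇒≼ : x ≼ y
    ≃⇒≽ : y ≼ x
open _≃_

-- The operations on ℝ act termwise, so ring identities hold in this strong form and the rational
-- solver proves them at each index.
_≗_ : ℝ → ℝ → Set
x ≗ y = ∀ n → seq x n ≡ seq y n

Eventually : (ℕ → Set) → Set
Eventually P = ∃ λ N → ∀ n → N ℕ.≤ n → P n

both : ∀ {P Q : ℕ → Set} → Eventually P → Eventually Q → Eventually (λ n → P n × Q n)
both (M , hM) (N , hN) = M ℕ.⊔ N , λ n n≥ →
  let (nM , nN) = ⊔-ℕ {M} {N} n≥ in hM n nM , hN n nN

eventually-map : ∀ {P Q : ℕ → Set} → (∀ n → P n → Q n) → Eventually P → Eventually Q
eventually-map f (N , h) = N , λ n n≥ → f n (h n n≥)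

-- Order on ℝ

p<p+ε : ∀ p {ε} → 0ℚ ℚ.< ε → p ℚ.< p ℚ.+ ε
p<p+ε p {ε} 0<ε = subst (ℚ._< p ℚ.+ ε) (ℚₚ.+-identityʳ p) (ℚₚ.+-monoʳ-< p 0<ε)

+-cancelʳ-<ℚ : ∀ r p q → p ℚ.+ r ℚ.< q ℚ.+ r → p ℚ.< q
+-cancelʳ-<ℚ r p q h = subst₂ ℚ._<_ (drop p) (drop q) (ℚₚ.+-monoˡ-< (ℚ.- r) h)
  where
  drop : ∀ p → p ℚ.+ r ℚ.- r ≡ p
  drop p = solve 2 (λ p r → p :+ r :- r := p) refl p r

eventually-≼ : ∀ {x y} → Eventually (λ n → seq x n ℚ.≤ seq y n) → x ≼ y
eventually-≼ {x} {y} h = le λ ε 0<ε →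
  eventually-map (λ n x≤y → ℚₚ.≤-<-trans x≤y (p<p+ε (seq y n) 0<ε)) h

pointwise-≼ : ∀ {x y} → (∀ n → seq x n ℚ.≤ seq y n) → x ≼ y
pointwise-≼ h = eventually-≼ (0 , λ n _ → h n)

≗⇒≼ : ∀ {x y} → x ≗ y → x ≼ y
≗⇒≼ h = pointwise-≼ (λ n → ℚₚ.≤-reflexive (h n))

≗⇒≃ : ∀ {x y} → x ≗ y → x ≃ y
≗⇒≃ h = antisym (≗⇒≼ h) (≗⇒≼ (λ n → sym (h n)))

≼-refl : ∀ {x} → x ≼ x
≼-refl = ≗⇒≼ (λ _ → refl)

≼-trans : ∀ {x y z} → x ≼ y → y ≼ z → x ≼ z
≼-trans {x} {y} {z} (le x≤y) (le y≤z) = le λ ε 0<ε → eventually-map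
  (λ n (p , q) → ℚₚ.<-trans p (subst (seq y n ℚ.+ ½ ℚ.* ε ℚ.<_)
    (solve 2 (λ z e → z :+ con ½ :* e :+ con ½ :* e := z :+ e) refl (seq z n) ε)
    (ℚₚ.+-monoˡ-< (½ ℚ.* ε) q)))
  (both (x≤y (½ ℚ.* ε) (half-pos 0<ε)) (y≤z (½ ℚ.* ε) (half-pos 0<ε)))

≃-sym : ∀ {x y} → x ≃ y → y ≃ x
≃-sym (antisym p q) = antisym q p

≃-trans : ∀ {x y z} → x ≃ y → y ≃ z → x ≃ z
≃-trans (antisym p q) (antisym p′ q′) = antisym (≼-trans p p′) (≼-trans q′ q)

≈⇒≃ : ∀ {x y} → x ≈ y → x ≃ y
≈⇒≃ {x} {y} x≈y = antisym
  (le λ ε 0<ε → eventually-map (λ n → ∣-∣⇒< (seq x n) (seq y n)) (x≈y ε 0<ε))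
  (le λ ε 0<ε → eventually-map
    (λ n h → ∣-∣⇒< (seq y n) (seq x n) (subst (ℚ._< ε) (∣-∣-sym (seq x n) (seq y n)) h))
    (x≈y ε 0<ε))

≃⇒≈ : ∀ {x y} → x ≃ y → x ≈ y
≃⇒≈ {x} {y} (antisym (le p) (le q)) ε 0<ε =
  eventually-map (λ n (h , k) → <⇒∣-∣ (seq x n) (seq y n) h k) (both (p ε 0<ε) (q ε 0<ε))

+-mono-≼ : ∀ {x y u v} → x ≼ y → u ≼ v → x + u ≼ y + v
+-mono-≼ {x} {y} {u} {v} (le x≤y) (le u≤v) = le λ ε 0<ε → eventually-map
  (λ n (p , q) → subst (seq x n ℚ.+ seq u n ℚ.<_)
    (solve 3 (λ y v e → (y :+ con ½ :* e) :+ (v :+ con ½ :* e) := (y :+ v) :+ e) refl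
      (seq y n) (seq v n) ε)
    (ℚₚ.+-mono-< p q))
  (both (x≤y (½ ℚ.* ε) (half-pos 0<ε)) (u≤v (½ ℚ.* ε) (half-pos 0<ε)))

≺⇒≼ : ∀ {x y} → x ≺ y → x ≼ y
≺⇒≼ {x} (lt (δ , 0<δ , h)) = eventually-≼
  (eventually-map (λ n p → ℚₚ.<⇒≤ (ℚₚ.<-trans (p<p+ε (seq x n) 0<δ) p)) h)

≺⇒⋡ : ∀ {x y} → x ≺ y → ¬ y ≼ x
≺⇒⋡ (lt (δ , 0<δ , h)) (le y≤x) with both h (y≤x δ 0<δ)
... | N , k = let (p , q) = k N ℕₚ.≤-refl in ℚₚ.<-asym p q

-- Comparing x and y at one late index, up to a margin, decides between
-- x ≤ y + ε and y < x.
⊀⇒≽ : ∀ {x y} → ¬ y ≺ x → x ≼ y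
⊀⇒≽ {x} {y} y⊀x = le λ ε 0<ε → near ε 0<ε
  where
  -- With threshold 3η at the index k, moving x and y between n and k costs η each. This gives x < y
  -- + 5η in one branch and leaves the gap 3η - 2η = η in the other.
  fifth = + 1 ℚ./ 5
  near : ∀ ε → 0ℚ ℚ.< ε → Eventually (λ n → seq x n ℚ.< seq y n ℚ.+ ε)
  near ε 0<ε = compare (cauchy x η 0<η) (cauchy y η 0<η)
    where
    η = fifth ℚ.* ε
    0<η : 0ℚ ℚ.< η
    0<η = *-pos (ℚₚ.positive⁻¹ fifth) 0<ε
    compare : CauchyLemmas.Close (seq x) η → CauchyLemmas.Close (seq y) η →
      Eventually (λ n → seq x n ℚ.< seq y n ℚ.+ ε)
    compare (M , hM) (N , hN) with seq x (M ℕ.⊔ N) ℚₚ.<? seq y (M ℕ.⊔ N) ℚ.+ (η ℚ.+ η ℚ.+ η)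
    ... | yes p = M ℕ.⊔ N , λ n n≥ →
      let (nM , nN) = ⊔-ℕ {M} {N} n≥
          k = M ℕ.⊔ N
          x-near = ∣-∣⇒< (seq x n) (seq x k) (hM n k nM (ℕₚ.m≤m⊔n M N))
          y-near = ∣-∣⇒< (seq y k) (seq y n) (hN k n (ℕₚ.m≤n⊔m M N) nN)
      in subst (seq x n ℚ.<_)
        (solve 2 (λ y e → let η = con fifth :* e in y :+ η :+ (η :+ η :+ η) :+ η := y :+ e)
          refl (seq y n) ε)
        (ℚₚ.<-trans x-near (ℚₚ.+-monoˡ-< η (ℚₚ.<-trans p (ℚₚ.+-monoˡ-< (η ℚ.+ η ℚ.+ η) y-near))))
    ... | no  p = contradiction (lt (η , 0<η , M ℕ.⊔ N , λ n n≥ →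
      let (nM , nN) = ⊔-ℕ {M} {N} n≥
          k = M ℕ.⊔ N
          x-near = ∣-∣⇒< (seq x k) (seq x n) (hM k n (ℕₚ.m≤m⊔n M N) nM)
          y-near = ∣-∣⇒< (seq y n) (seq y k) (hN n k nN (ℕₚ.m≤n⊔m M N))
      in +-cancelʳ-<ℚ η (seq y n ℚ.+ η) (seq x n)
        (ℚₚ.<-trans
          (subst (seq y n ℚ.+ η ℚ.+ η ℚ.<_)
            (solve 2 (λ y η → y :+ η :+ η :+ η := y :+ (η :+ η :+ η)) refl (seq y k) η)
            (ℚₚ.+-monoˡ-< η (ℚₚ.+-monoˡ-< η y-near)))
          (ℚₚ.≤-<-trans (ℚₚ.≮⇒≥ p) x-near)))) y⊀x

-- By `⊀⇒≽` it suffices to refute `b ≺ a`. Under that assumption `if-≻` refutes `y ≺ x`, hence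
-- `x ≼ y`, and `if-≼` gives the contradiction.
≼-by-cases : ∀ {a b} x y → (x ≼ y → a ≼ b) → (y ≺ x → a ≼ b) → a ≼ b
≼-by-cases x y if-≼ if-≻ = ⊀⇒≽ λ b≺a →
  ≺⇒⋡ b≺a (if-≼ (⊀⇒≽ λ y≺x → ≺⇒⋡ b≺a (if-≻ y≺x)))

≃-by-cases : ∀ {a b} x y → (x ≼ y → a ≃ b) → (y ≺ x → a ≃ b) → a ≃ b
≃-by-cases x y if-≼ if-≻ = antisym
  (≼-by-cases x y (λ h → ≃⇒≼ (if-≼ h)) (λ h → ≃⇒≼ (if-≻ h)))
  (≼-by-cases x y (λ h → ≃⇒≽ (if-≼ h)) (λ h → ≃⇒≽ (if-≻ h)))

≺-≼-trans : ∀ {x y z} → x ≺ y → y ≼ z → x ≺ z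
≺-≼-trans {x} {y} {z} (lt (δ , 0<δ , h)) (le y≤z) = lt (½ ℚ.* δ , half-pos 0<δ , eventually-map
  (λ n (p , q) → +-cancelʳ-<ℚ (½ ℚ.* δ) (seq x n ℚ.+ ½ ℚ.* δ) (seq z n)
    (subst (ℚ._< seq z n ℚ.+ ½ ℚ.* δ)
      (solve 2 (λ x e → x :+ e := x :+ con ½ :* e :+ con ½ :* e) refl (seq x n) δ)
      (ℚₚ.<-trans p q)))
  (both h (y≤z (½ ℚ.* δ) (half-pos 0<δ))))

-- The form in which most inequalities below are proved: a nonnegative certificate `e` and a ring
-- identity for the difference of the sides.
≼-by : ∀ {x y e} → 0ℝ ≼ e → (y - x) ≗ e → x ≼ y
≼-by {x} {y} {e} 0≼e h = ≼-trans
  (≗⇒≼ (λ n → sym (ℚₚ.+-identityʳ (seq x n))))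
  (≼-trans (+-mono-≼ (≼-refl {x}) 0≼e)
    (≗⇒≼ (λ n → trans (cong (λ k → seq x n ℚ.+ k) (sym (h n)))
      (solve 2 (λ x y → x :+ (y :- x) := y) refl (seq x n) (seq y n)))))

≼⇒0≼- : ∀ {x y} → x ≼ y → 0ℝ ≼ y - x
≼⇒0≼- {x} {y} h = ≼-trans (≗⇒≼ (λ n → sym (ℚₚ.+-inverseʳ (seq x n))))
  (+-mono-≼ h (≼-refl { - x}))

≺⇒0≺- : ∀ {x y} → x ≺ y → 0ℝ ≺ y - x
≺⇒0≺- {x} {y} (lt (δ , 0<δ , h)) = lt (δ , 0<δ , eventually-map
  (λ n p → subst (ℚ._< seq y n ℚ.- seq x n)
    (solve 2 (λ x e → x :+ e :- x := con 0ℚ :+ e) refl (seq x n) δ)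
    (ℚₚ.+-monoˡ-< (ℚ.- seq x n) p)) h)

-- Sign rules and cancellation for products and squares

0≺1 : 0ℝ ≺ 1ℝ
0≺1 = lt (½ , 0<½ , 0 , λ _ _ → subst (ℚ._< 1ℚ) (sym (ℚₚ.+-identityˡ ½)) (p<p+ε ½ 0<½))

0≼+ : ∀ {x y} → 0ℝ ≼ x → 0ℝ ≼ y → 0ℝ ≼ x + y
0≼+ 0≼x 0≼y = ≼-trans (≗⇒≼ (λ _ → refl)) (+-mono-≼ 0≼x 0≼y)

0≺+ : ∀ {x y} → 0ℝ ≼ x → 0ℝ ≺ y → 0ℝ ≺ x + y
0≺+ {x} {y} 0≼x 0≺y = ≺-≼-trans 0≺y (≼-by 0≼x
  (λ n → solve 2 (λ x y → x :+ y :- y := x) refl (seq x n) (seq y n)))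

0≺* : ∀ {x y} → 0ℝ ≺ x → 0ℝ ≺ y → 0ℝ ≺ x * y
0≺* {x} {y} (lt (δ , 0<δ , h)) (lt (η , 0<η , k)) = lt (δ ℚ.* η , *-pos 0<δ 0<η , eventually-map
  (λ n (p , q) →
    let δ<x = subst (ℚ._< seq x n) (ℚₚ.+-identityˡ δ) p
        η<y = subst (ℚ._< seq y n) (ℚₚ.+-identityˡ η) q
    in subst (ℚ._< seq x n ℚ.* seq y n) (sym (ℚₚ.+-identityˡ (δ ℚ.* η)))
      (ℚₚ.<-trans (ℚₚ.*-monoʳ-<-pos δ {{ℚ.positive 0<δ}} η<y)
        (ℚₚ.*-monoˡ-<-pos (seq y n) {{ℚ.positive (ℚₚ.<-trans 0<η η<y)}} δ<x)))
  (both h k))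

≃0⇒*≃0 : ∀ {x} y → x ≃ 0ℝ → y * x ≃ 0ℝ
≃0⇒*≃0 {x} y x≃0 = ≈⇒≃ (λ ε 0<ε → small ε 0<ε (bounded (seq y) (cauchy y)))
  where
  drop-0 : ∀ p → p ℚ.- 0ℚ ≡ p
  drop-0 = solve 1 (λ p → p :- con 0ℚ := p) refl
  small : ∀ ε → 0ℚ ℚ.< ε → Bounded (seq y) →
    Eventually (λ n → ∣ seq y n ℚ.* seq x n ℚ.- 0ℚ ∣ ℚ.< ε)
  small ε 0<ε (B , 0<B , y-bound) = eventually-map
    (λ n (p , q) → subst₂ (λ u v → ∣ u ∣ ℚ.< v)
      (sym (drop-0 (seq y n ℚ.* seq x n))) (recip-cancel B ε 0<B)
      (product-< {seq y n} {seq x n} 0<δ p (subst (λ u → ∣ u ∣ ℚ.< δ) (drop-0 (seq x n)) q)))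
    (both y-bound (≃⇒≈ x≃0 δ 0<δ))
    where
    δ = ε ℚ.* recip B
    0<δ : 0ℚ ℚ.< δ
    0<δ = *-pos 0<ε (recip-pos 0<B)

0≼* : ∀ {x y} → 0ℝ ≼ x → 0ℝ ≼ y → 0ℝ ≼ x * y
0≼* {x} {y} 0≼x 0≼y = ≼-by-cases y 0ℝ
  (λ y≼0 → ≃⇒≽ (≃0⇒*≃0 x (antisym y≼0 0≼y)))
  (λ 0≺y → ≼-by-cases x 0ℝ
    (λ x≼0 → ≼-trans (≃⇒≽ (≃0⇒*≃0 y (antisym x≼0 0≼x)))
      (≗⇒≼ (λ n → ℚₚ.*-comm (seq y n) (seq x n))))
    (λ 0≺x → ≺⇒≼ (0≺* 0≺x 0≺y)))

0≼² : ∀ x → 0ℝ ≼ x ²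
0≼² x = ≼-by-cases 0ℝ x (λ 0≼x → 0≼* 0≼x 0≼x) (λ x≺0 →
  let 0≼-x = ≼⇒0≼- (≺⇒≼ x≺0) in
  ≼-trans (0≼* 0≼-x 0≼-x)
    (≗⇒≼ (λ n → solve 1 (λ x → (con 0ℚ :- x) :* (con 0ℚ :- x) := x :* x) refl (seq x n))))

-- Rewriting along `p ≃ q` inside a polynomial: the cofactor `k` of `p - q` takes the place of
-- congruence lemmas.
≃-by : ∀ {x y p q} → p ≃ q → ∀ k → (x - y) ≗ (k * (p - q)) → x ≃ y
≃-by {x} {y} {p} {q} p≃q k h = antisym
  (≼-by (≃⇒≽ (≃0⇒*≃0 (- k) p-q≃0)) negated)
  (≼-by (≃⇒≽ (≃0⇒*≃0 k p-q≃0)) h)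
  where
  p-q≃0 : p - q ≃ 0ℝ
  p-q≃0 = antisym
    (≼-by (≼⇒0≼- (≃⇒≼ p≃q)) (λ n → solve 2 (λ p q → con 0ℚ :- (p :- q) := q :- p) refl (seq p n) (seq q n)))
    (≼⇒0≼- (≃⇒≽ p≃q))
  negated : (y - x) ≗ (- k * (p - q))
  negated n = trans (solve 2 (λ x y → y :- x := :- (x :- y)) refl (seq x n) (seq y n))
    (trans (cong ℚ.-_ (h n))
      (solve 2 (λ k e → :- (k :* e) := :- k :* e) refl (seq k n) (seq p n ℚ.- seq q n)))

*-cancelˡ-≼ : ∀ {c x y} → 0ℝ ≺ c → c * x ≼ c * y → x ≼ y
*-cancelˡ-≼ {c} {x} {y} 0≺c cx≼cy = ⊀⇒≽ λ y≺x → ≺⇒⋡ (0≺* 0≺c (≺⇒0≺- y≺x))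
  (≼-by (≼⇒0≼- cx≼cy) (λ n → solve 3 (λ c x y → con 0ℚ :- c :* (x :- y) := c :* y :- c :* x)
    refl (seq c n) (seq x n) (seq y n)))

*-cancelˡ-≃ : ∀ {c x y} → 0ℝ ≺ c → c * x ≃ c * y → x ≃ y
*-cancelˡ-≃ 0≺c (antisym p q) = antisym (*-cancelˡ-≼ 0≺c p) (*-cancelˡ-≼ 0≺c q)

-- If b < a, then a² - b² = (a - b)(2b + (a - b)) is positive. The sign of `a` is left open, so
-- differences can be inserted for it.
²-cancel-≼ : ∀ {a b} → 0ℝ ≼ b → a ² ≼ b ² → a ≼ b
²-cancel-≼ {a} {b} 0≼b a²≼b² = ⊀⇒≽ λ b≺a →
  let 0≺a-b = ≺⇒0≺- b≺a in
  ≺⇒⋡ (0≺* 0≺a-b (0≺+ (0≼+ 0≼b 0≼b) 0≺a-b))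
    (≼-by (≼⇒0≼- a²≼b²) (λ n → solve 2
      (λ a b → con 0ℚ :- (a :- b) :* (b :+ b :+ (a :- b)) := b :* b :- a :* a) refl (seq a n) (seq b n)))

x≼x⊔y : ∀ {x y} → x ≼ x ⊔ y
x≼x⊔y {x} {y} = pointwise-≼ (λ n → ℚₚ.p≤p⊔q (seq x n) (seq y n))

y≼x⊔y : ∀ {x y} → y ≼ x ⊔ y
y≼x⊔y {x} {y} = pointwise-≼ (λ n → ℚₚ.p≤q⊔p (seq x n) (seq y n))

⊔-lub : ∀ {x y z} → x ≼ z → y ≼ z → x ⊔ y ≼ z
⊔-lub (le x≤z) (le y≤z) = le λ ε 0<ε →
  eventually-map (λ n (p , q) → ⊔-< p q) (both (x≤z ε 0<ε) (y≤z ε 0<ε))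

-- Square roots and quotients

√-bounds : ∀ x n → SqrtBounds (seq x n ℚ.⊔ 0ℚ) (seq (√ x) n) (sqrtWidth (seq x n ℚ.⊔ 0ℚ) n)
√-bounds x n = sqrtLower-bounds (ℚₚ.p≤q⊔p (seq x n) 0ℚ) n

0≼√ : ∀ x → 0ℝ ≼ √ x
0≼√ x = pointwise-≼ (λ n → SqrtBounds.nonNeg (√-bounds x n))

-- One direction is the lower bound of the bisection. For the other, the error is at most (s + w)² -
-- s² = (2s + w)w, where 2s + w stays bounded and the width w tends to 0.
√-square : ∀ {x} → 0ℝ ≼ x → (√ x) ² ≃ x
√-square {x} 0≼x = antisym
  (≼-trans (pointwise-≼ (λ n → SqrtBounds.lower (√-bounds x n))) (⊔-lub ≼-refl 0≼x))
  (le λ ε 0<ε → approx ε 0<ε (bounded s (cauchy (√ x))) (bounded q (cauchy (x ⊔ 0ℝ))))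
  where
  s q w : ℕ → ℚ
  s = seq (√ x)
  q = seq (x ⊔ 0ℝ)
  w n = sqrtWidth (q n) n
  0≤w : ∀ n → 0ℚ ℚ.≤ w n
  0≤w n = sqrtWidth-nonNeg n (ℚₚ.p≤q⊔p (seq x n) 0ℚ)
  0≤s : ∀ n → 0ℚ ℚ.≤ s n
  0≤s n = SqrtBounds.nonNeg (√-bounds x n)
  w-small : ∀ {C δ} n → ∣ q n ∣ ℚ.< C → (1ℚ ℚ.+ C) ℚ.* ½^ n ℚ.< δ → w n ℚ.< δ
  w-small n q<C h = ℚₚ.≤-<-trans
    (ℚₚ.*-monoʳ-≤-nonNeg (½^ n) {{ℚ.nonNegative (ℚₚ.<⇒≤ (½^-pos n))}}
      (ℚₚ.+-monoʳ-≤ 1ℚ (ℚₚ.≤-trans (p≤∣p∣ (q n)) (ℚₚ.<⇒≤ q<C)))) h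
  approx : ∀ ε → 0ℚ ℚ.< ε → Bounded s → Bounded q →
    Eventually (λ n → seq x n ℚ.< s n ℚ.* s n ℚ.+ ε)
  approx ε 0<ε (B , 0<B , s-bound) (C , _ , q-bound) = eventually-map
    (λ n (s<B , q<C , small₁ , small₂) →
      let w<1 = w-small n q<C small₁
          w<δ = w-small n q<C small₂
          r = s n ℚ.+ s n ℚ.+ w n
          0≤r = ℚₚ.+-mono-≤ (ℚₚ.+-mono-≤ (0≤s n) (0≤s n)) (0≤w n)
          s<B′ = ℚₚ.≤-<-trans (p≤∣p∣ (s n)) s<B
          r<D = subst (ℚ._< D) (sym (ℚₚ.0≤p⇒∣p∣≡p 0≤r))
            (ℚₚ.+-mono-< (ℚₚ.+-mono-< s<B′ s<B′) w<1)
          rw<ε = subst (∣ r ℚ.* w n ∣ ℚ.<_) (recip-cancel D ε 0<D)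
            (product-< {r} {w n} 0<δ r<D
              (subst (ℚ._< δ) (sym (ℚₚ.0≤p⇒∣p∣≡p (0≤w n))) w<δ))
      in ℚₚ.≤-<-trans (ℚₚ.p≤p⊔q (seq x n) 0ℚ) (ℚₚ.<-trans (SqrtBounds.upper (√-bounds x n))
        (subst (ℚ._< s n ℚ.* s n ℚ.+ ε)
          (solve 2 (λ s w → s :* s :+ (s :+ s :+ w) :* w := (s :+ w) :* (s :+ w)) refl (s n) (w n))
          (ℚₚ.+-monoʳ-< (s n ℚ.* s n) (ℚₚ.≤-<-trans (p≤∣p∣ (r ℚ.* w n)) rw<ε)))))
    (both s-bound (both q-bound (both (½^-small (1ℚ ℚ.+ C) 1ℚ 0<1) (½^-small (1ℚ ℚ.+ C) δ 0<δ))))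
    where
    -- Bounds 2s + w once s < B and w < 1.
    D = B ℚ.+ B ℚ.+ 1ℚ
    0<D : 0ℚ ℚ.< D
    0<D = ℚₚ.+-mono-< (ℚₚ.+-mono-< 0<B 0<B) 0<1
    δ = ε ℚ.* recip D
    0<δ : 0ℚ ℚ.< δ
    0<δ = *-pos 0<ε (recip-pos 0<D)

inverse : (y : ℝ) → y # 0ℝ → ℝ
inverse y y#0 = mkℝ (λ n → recip (seq y n)) (recip-cauchy (seq y) (cauchy y) (#0⇒away y y#0))

*-inverseʳ : ∀ y y#0 → y * inverse y y#0 ≃ 1ℝ
*-inverseʳ y y#0 with #0⇒away y y#0
... | δ , 0<δ , h = antisym
  (eventually-≼ (eventually-map (λ n p → ℚₚ.≤-reflexive (cancel n p)) h))
  (eventually-≼ (eventually-map (λ n p → ℚₚ.≤-reflexive (sym (cancel n p))) h))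
  where
  cancel : ∀ n → δ ℚ.< ∣ seq y n ∣ → seq y n ℚ.* recip (seq y n) ≡ 1ℚ
  cancel n p = recip-inverseʳ (0<∣p∣⇒p≢0 0<δ p)

÷-mono-≼ : ∀ {a b c d} (c#0 : c # 0ℝ) (d#0 : d # 0ℝ) → 0ℝ ≺ c → 0ℝ ≺ d →
  a * d ≼ b * c → a ÷ c ⟨ c#0 ⟩ ≼ b ÷ d ⟨ d#0 ⟩
÷-mono-≼ {a} {b} {c} {d} c#0 d#0 0≺c 0≺d h = *-cancelˡ-≼ (0≺* 0≺c 0≺d)
  (≼-trans (≃⇒≼ left) (≼-trans h (≃⇒≽ right)))
  where
  left : c * d * (a ÷ c ⟨ c#0 ⟩) ≃ a * d
  left = ≃-by (*-inverseʳ c c#0) (a * d) (λ n → solve 4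
    (λ a c d r → c :* d :* (a :* r) :- a :* d := a :* d :* (c :* r :- con 1ℚ))
    refl (seq a n) (seq c n) (seq d n) (recip (seq c n)))
  right : c * d * (b ÷ d ⟨ d#0 ⟩) ≃ b * c
  right = ≃-by (*-inverseʳ d d#0) (b * c) (λ n → solve 4
    (λ b c d r → c :* d :* (b :* r) :- b :* c := b :* c :* (d :* r :- con 1ℚ))
    refl (seq b n) (seq c n) (seq d n) (recip (seq d n)))

÷-cancel : ∀ {a c t} (c#0 : c # 0ℝ) → t ≃ a ÷ c ⟨ c#0 ⟩ → c * t ≃ a
÷-cancel {a} {c} {t} c#0 t≃a/c = ≃-trans
  (≃-by {y = c * (a ÷ c ⟨ c#0 ⟩)} t≃a/c c (λ n → solve 3 (λ c t q → c :* t :- c :* q := c :* (t :- q))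
    refl (seq c n) (seq t n) (seq (a ÷ c ⟨ c#0 ⟩) n)))
  (≃-by (*-inverseʳ c c#0) a (λ n → solve 3
    (λ c a r → c :* (a :* r) :- a := a :* (c :* r :- con 1ℚ))
    refl (seq c n) (seq a n) (recip (seq c n))))

#0⇒0≺² : ∀ x → x # 0ℝ → 0ℝ ≺ x ²
#0⇒0≺² x (inj₁ x<0) = ≺-≼-trans (0≺* 0≺-x 0≺-x)
  (≗⇒≼ (λ n → solve 1 (λ x → (con 0ℚ :- x) :* (con 0ℚ :- x) := x :* x) refl (seq x n)))
  where
  0≺-x : 0ℝ ≺ 0ℝ - x
  0≺-x = ≺⇒0≺- (lt x<0)
#0⇒0≺² x (inj₂ 0<x) = 0≺* {x} {x} (lt 0<x) (lt 0<x)

*-monoʳ-≼ : ∀ {a b c} → 0ℝ ≼ a → b ≼ c → a * b ≼ a * c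
*-monoʳ-≼ {a} {b} {c} 0≼a b≼c = ≼-by (0≼* 0≼a (≼⇒0≼- b≼c)) (λ n → solve 3
  (λ a b c → a :* c :- a :* b := a :* (c :- b)) refl (seq a n) (seq b n) (seq c n))

-- Delivery times in the coordinates u = x − 1, s = 1 − t

two three : ∀ {k} → Polynomial k
two   = con (+ 2 ℚ./ 1)
three = con (+ 3 ℚ./ 1)

3ℝ : ℝ
3ℝ = fromℚ (+ 3 ℚ./ 1)

-- The squared distance from the finisher's start to the point at distance s
-- before T, by the law of cosines.
dist² : (z u s : ℝ) → ℝ
dist² z u s = z * z + 2ℝ * (u * s) + s * s

dist²′ : ∀ {k} → (z u s : Polynomial k) → Polynomial k
dist²′ z u s = z :* z :+ two :* (u :* s) :+ s :* s

-- Characterises the distance instead of fixing it as a root, so that the root-free expression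
-- `w + z - s₁` also qualifies at the peak.
record IsDist (z u s d : ℝ) : Set where
  constructor isDist
  field
    nonNeg : 0ℝ ≼ d
    square : d ² ≃ dist² z u s

-- Nonnegative reals with equal squares are equal; the opposite inequality follows by exchanging the
-- roles.
dist-mono : ∀ {z u s r d e} → s ≃ r → IsDist z u s d → IsDist z u r e → d ≼ e
dist-mono {z} {u} {s} {r} s≃r (isDist 0≼d d²) (isDist 0≼e e²) = ²-cancel-≼ 0≼e
  (≃⇒≼ (≃-trans d² (≃-trans dist²-cong (≃-sym e²))))
  where
  dist²-cong : dist² z u s ≃ dist² z u r
  dist²-cong = ≃-by s≃r (2ℝ * u + s + r) (λ n → solve 4
    (λ z u s r → dist²′ z u s :- dist²′ z u r := (two :* u :+ s :+ r) :* (s :- r))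
    refl (seq z n) (seq u n) (seq s n) (seq r n))

-- Triangle inequality and convexity of the distance

module _ {z u : ℝ} (-z≼u : - z ≼ u) (u≼z : u ≼ z) where

  0≼z+u : 0ℝ ≼ z + u
  0≼z+u = ≼-by (≼⇒0≼- -z≼u) (λ n → solve 2 (λ z u → z :+ u :- con 0ℚ := u :- (:- z))
    refl (seq z n) (seq u n))

  -- The difference d² - (z - s)² equals 2s(z + u), which is nonnegative.
  triangle : ∀ {s d} → 0ℝ ≼ s → IsDist z u s d → z ≼ d + s
  triangle {s} {d} 0≼s (isDist 0≼d d²) = ≼-by (≼⇒0≼- z-s≼d) (λ n → solve 3
    (λ z s d → d :+ s :- z := d :- (z :- s)) refl (seq z n) (seq s n) (seq d n))
    where
    z-s≼d : z - s ≼ d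
    z-s≼d = ²-cancel-≼ 0≼d (≼-trans
      (≼-by (0≼* (0≼+ 0≼s 0≼s) 0≼z+u) (λ n → solve 3
        (λ z u s → dist²′ z u s :- (z :- s) :* (z :- s) := (s :+ s) :* (z :+ u))
        refl (seq z n) (seq u n) (seq s n)))
      (≃⇒≽ d²))

  -- The left side is the inner product of the vectors (u + s, y) and (u + r, y) with u² + y² = z².
  -- Their Gram determinant is (z + u)(z - u)(s - r)² ≥ 0.
  cauchy-schwarz : ∀ {s r d e} → IsDist z u s d → IsDist z u r e →
    z * z + u * (s + r) + s * r ≼ d * e
  cauchy-schwarz {s} {r} {d} {e} (isDist 0≼d d²) (isDist 0≼e e²) = ²-cancel-≼ (0≼* 0≼d 0≼e)
    (≼-trans gram (≃⇒≽ (≃-trans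
      (≃-by {y = d * d * dist² z u r} e² (d * d) (λ n → solve 5
        (λ z u r d e → d :* e :* (d :* e) :- d :* d :* dist²′ z u r
          := d :* d :* (e :* e :- dist²′ z u r))
        refl (seq z n) (seq u n) (seq r n) (seq d n) (seq e n)))
      (≃-by d² (dist² z u r) (λ n → solve 5
        (λ z u s r d → d :* d :* dist²′ z u r :- dist²′ z u s :* dist²′ z u r
          := dist²′ z u r :* (d :* d :- dist²′ z u s))
        refl (seq z n) (seq u n) (seq s n) (seq r n) (seq d n))))))
    where
    gram : (z * z + u * (s + r) + s * r) ² ≼ dist² z u s * dist² z u r
    gram = ≼-by (0≼* (0≼* 0≼z+u (≼⇒0≼- u≼z)) (0≼² (s - r))) (λ n → solve 4
      (λ z u s r → let p = z :* z :+ u :* (s :+ r) :+ s :* r in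
        dist²′ z u s :* dist²′ z u r :- p :* p
          := (z :+ u) :* (z :- u) :* ((s :- r) :* (s :- r)))
      refl (seq z n) (seq u n) (seq s n) (seq r n))

  -- The point at s′ is the combination of those at s and r with weights r - s′ and s′ - s. After
  -- squaring, the sides differ only in the mixed term, which `cauchy-schwarz` controls.
  dist-convex : ∀ {s s′ r d d′ e} → s ≼ s′ → s′ ≼ r →
    IsDist z u s d → IsDist z u s′ d′ → IsDist z u r e →
    (r - s) * d′ ≼ (r - s′) * d + (s′ - s) * e
  dist-convex {s} {s′} {r} {d} {d′} {e} s≼s′ s′≼r D@(isDist 0≼d d²) (isDist _ d′²) E@(isDist 0≼e e²) =
    ²-cancel-≼ (0≼+ (0≼* 0≼a 0≼d) (0≼* 0≼b 0≼e))
      (≼-trans (≃⇒≼ expand-d′) (≼-trans mixed (≼-trans (≃⇒≽ expand-d) (≃⇒≽ expand-e))))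
    where
    a = r - s′
    b = s′ - s
    0≼a : 0ℝ ≼ a
    0≼a = ≼⇒0≼- s′≼r
    0≼b : 0ℝ ≼ b
    0≼b = ≼⇒0≼- s≼s′
    expand-d′ : ((r - s) * d′) ² ≃ (r - s) ² * dist² z u s′
    expand-d′ = ≃-by d′² ((r - s) ²) (λ n → solve 6
      (λ z u s s′ r d′ → let c = r :- s in
        c :* d′ :* (c :* d′) :- c :* c :* dist²′ z u s′ := c :* c :* (d′ :* d′ :- dist²′ z u s′))
      refl (seq z n) (seq u n) (seq s n) (seq s′ n) (seq r n) (seq d′ n))
    mixed : (r - s) ² * dist² z u s′ ≼ a ² * dist² z u s + 2ℝ * (a * b) * (d * e) + b ² * dist² z u r
    mixed = ≼-by
      (0≼* (0≼+ (0≼* 0≼a 0≼b) (0≼* 0≼a 0≼b)) (≼⇒0≼- (cauchy-schwarz D E)))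
      (λ n → solve 7 (λ z u s s′ r d e → let a = r :- s′ ; b = s′ :- s in
        a :* a :* dist²′ z u s :+ two :* (a :* b) :* (d :* e) :+ b :* b :* dist²′ z u r
          :- (r :- s) :* (r :- s) :* dist²′ z u s′
        := (a :* b :+ a :* b) :* (d :* e :- (z :* z :+ u :* (s :+ r) :+ s :* r)))
        refl (seq z n) (seq u n) (seq s n) (seq s′ n) (seq r n) (seq d n) (seq e n))
    expand-d : a ² * d ² + 2ℝ * (a * b) * (d * e) + b ² * dist² z u r
      ≃ a ² * dist² z u s + 2ℝ * (a * b) * (d * e) + b ² * dist² z u r
    expand-d = ≃-by d² (a ²) (λ n → solve 7 (λ z u s s′ r d e → let a = r :- s′ ; b = s′ :- s in
      a :* a :* (d :* d) :+ two :* (a :* b) :* (d :* e) :+ b :* b :* dist²′ z u r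
        :- (a :* a :* dist²′ z u s :+ two :* (a :* b) :* (d :* e) :+ b :* b :* dist²′ z u r)
      := a :* a :* (d :* d :- dist²′ z u s))
      refl (seq z n) (seq u n) (seq s n) (seq s′ n) (seq r n) (seq d n) (seq e n))
    expand-e : (a * d + b * e) ² ≃ a ² * d ² + 2ℝ * (a * b) * (d * e) + b ² * dist² z u r
    expand-e = ≃-by e² (b ²) (λ n → solve 7 (λ z u r a b d e →
      (a :* d :+ b :* e) :* (a :* d :+ b :* e)
        :- (a :* a :* (d :* d) :+ two :* (a :* b) :* (d :* e) :+ b :* b :* dist²′ z u r)
      := b :* b :* (e :* e :- dist²′ z u r))
      refl (seq z n) (seq u n) (seq r n) (seq a n) (seq b n) (seq d n) (seq e n))

  -- The maximum of the ratio in s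

  module Peak {w s₁ : ℝ} (0≺z : 0ℝ ≺ z) (0≼w : 0ℝ ≼ w) (w² : w ² ≃ z * z + z * u)
    (peak : 2ℝ * (w + z) * s₁ ≃ z * (w + 2ℝ * z)) where

    0≼z : 0ℝ ≼ z
    0≼z = ≺⇒≼ 0≺z

    0≺w+z : 0ℝ ≺ w + z
    0≺w+z = 0≺+ 0≼w 0≺z

    0≺2[w+z] : 0ℝ ≺ 2ℝ * (w + z)
    0≺2[w+z] = ≺-≼-trans (0≺+ (≺⇒≼ 0≺w+z) 0≺w+z)
      (≗⇒≼ (λ n → solve 2 (λ w z → w :+ z :+ (w :+ z) := two :* (w :+ z)) refl (seq w n) (seq z n)))

    0≼s₁ : 0ℝ ≼ s₁
    0≼s₁ = *-cancelˡ-≼ 0≺2[w+z] (≼-trans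
      (≼-by (0≼* 0≼z (0≼+ 0≼w (0≼+ 0≼z 0≼z))) (λ n → solve 2
        (λ w z → z :* (w :+ two :* z) :- two :* (w :+ z) :* con 0ℚ := z :* (w :+ (z :+ z)))
        refl (seq w n) (seq z n)))
      (≃⇒≽ peak))

    s₁≼z : s₁ ≼ z
    s₁≼z = *-cancelˡ-≼ 0≺2[w+z] (≼-trans (≃⇒≼ peak)
      (≼-by (0≼* 0≼z 0≼w) (λ n → solve 2
        (λ w z → two :* (w :+ z) :* z :- z :* (w :+ two :* z) := z :* w) refl (seq w n) (seq z n))))

    -- Makes the denominator d + s equal to w + z at s₁. Multiplied by z, the squared equation is a
    -- combination of `peak` with cofactor -w and `w²` with cofactor 2s₁.
    peak-dist : IsDist z u s₁ (w + z - s₁)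
    peak-dist = isDist
      (≼-by (0≼+ 0≼w (≼⇒0≼- s₁≼z)) (λ n → solve 3
        (λ w z s → w :+ z :- s :- con 0ℚ := w :+ (z :- s)) refl (seq w n) (seq z n) (seq s₁ n)))
      (*-cancelˡ-≃ 0≺z (≃-trans
        (≃-by {y = z * dist² z u s₁ + 2ℝ * s₁ * (w * w - (z * z + z * u))} peak (- w) (λ n → solve 4
          (λ z u w s → z :* ((w :+ z :- s) :* (w :+ z :- s))
            :- (z :* dist²′ z u s :+ two :* s :* (w :* w :- (z :* z :+ z :* u)))
            := :- w :* (two :* (w :+ z) :* s :- z :* (w :+ two :* z)))
          refl (seq z n) (seq u n) (seq w n) (seq s₁ n)))
        (≃-by w² (2ℝ * s₁) (λ n → solve 4
          (λ z u w s → z :* dist²′ z u s :+ two :* s :* (w :* w :- (z :* z :+ z :* u))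
            :- z :* dist²′ z u s := two :* s :* (w :* w :- (z :* z :+ z :* u)))
          refl (seq z n) (seq u n) (seq w n) (seq s₁ n)))))

    w²≼2z² : w ² ≼ 2ℝ * z ²
    w²≼2z² = ≼-trans (≃⇒≼ w²) (≼-by (0≼* 0≼z (≼⇒0≼- u≼z)) (λ n → solve 2
      (λ z u → two :* (z :* z) :- (z :* z :+ z :* u) := z :* (z :- u)) refl (seq z n) (seq u n)))

    -- The peak inequality, solved for d and cleared of denominators. After
    -- squaring, the difference of the sides is (2z² − w²)(2(w + z)s − z(w + 2z))²,
    -- which vanishes at s = s₁.
    dist-lower-bound : ∀ {s d} → IsDist z u s d →
      z * (w + z) ² + (2ℝ * w ² + 2ℝ * (w * z) - z ²) * s ≼ (2ℝ * w + 3ℝ * z) * (z * d)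
    dist-lower-bound {s} {d} (isDist 0≼d d²) = ²-cancel-≼
      (0≼* (≼-trans (0≼+ (0≼+ 0≼w 0≼w) (0≼+ 0≼z (0≼+ 0≼z 0≼z))) (≗⇒≼ (λ n → solve 2
        (λ w z → w :+ w :+ (z :+ (z :+ z)) := two :* w :+ three :* z) refl (seq w n) (seq z n))))
        (0≼* 0≼z 0≼d))
      (≼-trans
        (≼-by {y = (2ℝ * w + 3ℝ * z) ² * scaled} (0≼* (≼⇒0≼- w²≼2z²) (0≼² (2ℝ * (w + z) * s - z * (w + 2ℝ * z)))) (λ n → solve 3
          (λ z w s → let
            a = two :* w :+ three :* z
            b = z :* ((w :+ z) :* (w :+ z)) :+ (two :* (w :* w) :+ two :* (w :* z) :- z :* z) :* s
            c = two :* (w :+ z) :* s :- z :* (w :+ two :* z)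
            in a :* a :* (z :* z :* (z :* z) :+ two :* (z :* s) :* (w :* w :- z :* z) :+ z :* z :* (s :* s))
              :- b :* b := (two :* (z :* z) :- w :* w) :* (c :* c))
          refl (seq z n) (seq w n) (seq s n)))
        (≃⇒≽ (≃-trans
          (≃-by {y = (2ℝ * w + 3ℝ * z) ² * z ² * dist² z u s} d² ((2ℝ * w + 3ℝ * z) ² * z ²) (λ n → solve 5
            (λ z u w s d → let a = two :* w :+ three :* z in
              a :* (z :* d) :* (a :* (z :* d)) :- a :* a :* (z :* z) :* dist²′ z u s
                := a :* a :* (z :* z) :* (d :* d :- dist²′ z u s))
            refl (seq z n) (seq u n) (seq w n) (seq s n) (seq d n)))
          (≃-by w² (- ((2ℝ * w + 3ℝ * z) ² * (2ℝ * (z * s)))) (λ n → solve 4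
            (λ z u w s → let a = two :* w :+ three :* z in
              a :* a :* (z :* z) :* dist²′ z u s
                :- a :* a :* (z :* z :* (z :* z) :+ two :* (z :* s) :* (w :* w :- z :* z) :+ z :* z :* (s :* s))
              := :- (a :* a :* (two :* (z :* s))) :* (w :* w :- (z :* z :+ z :* u)))
            refl (seq z n) (seq u n) (seq w n) (seq s n))))))
      where
      -- This is z² times the squared distance, with zu replaced by w² - z² to eliminate u.
      scaled = z * z * (z * z) + 2ℝ * (z * s) * (w * w - z * z) + z * z * (s * s)

    -- By `peak`, (w + z)(z + 2s₁) = z(2w + 3z), so multiplying by w + z turns the claim into a
    -- rearrangement of `dist-lower-bound`.
    peak-bound : ∀ {s d} → IsDist z u s d → (z + 2ℝ * s) * (w + z) ≼ (z + 2ℝ * s₁) * (d + s)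
    peak-bound {s} {d} D = *-cancelˡ-≼ 0≺w+z (≼-trans
      (≼-by {y = z * (2ℝ * w + 3ℝ * z) * (d + s)} (≼⇒0≼- (dist-lower-bound D)) (λ n → solve 4
        (λ z w s d → z :* (two :* w :+ three :* z) :* (d :+ s)
            :- (w :+ z) :* ((z :+ two :* s) :* (w :+ z))
          := (two :* w :+ three :* z) :* (z :* d)
            :- (z :* ((w :+ z) :* (w :+ z)) :+ (two :* (w :* w) :+ two :* (w :* z) :- z :* z) :* s))
        refl (seq z n) (seq w n) (seq s n) (seq d n)))
      (≃⇒≽ (≃-by peak (d + s) (λ n → solve 5
        (λ z w s d s₁ → (w :+ z) :* ((z :+ two :* s₁) :* (d :+ s)) :- z :* (two :* w :+ three :* z) :* (d :+ s)
          := (d :+ s) :* (two :* (w :+ z) :* s₁ :- z :* (w :+ two :* z)))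
        refl (seq z n) (seq w n) (seq s n) (seq d n) (seq s₁ n)))))

    ratio-at-peak : ∀ {s s′ d d′} → 0ℝ ≼ s → s′ ≃ s₁ → IsDist z u s d → IsDist z u s′ d′ →
      (z + 2ℝ * s) * (d′ + s′) ≼ (z + 2ℝ * s′) * (d + s)
    ratio-at-peak {s} {s′} {d} {d′} 0≼s s′≃s₁ D D′ = ≼-trans
      (≼-by (0≼* (0≼+ 0≼z (0≼+ 0≼s 0≼s)) (0≼+ (≼⇒0≼- (dist-mono s′≃s₁ D′ peak-dist)) (≼⇒0≼- (≃⇒≼ s′≃s₁))))
        (λ n → solve 6 (λ z w s s′ s₁ d′ →
          (z :+ two :* s) :* (w :+ z) :- (z :+ two :* s) :* (d′ :+ s′)
            := (z :+ (s :+ s)) :* (w :+ z :- s₁ :- d′ :+ (s₁ :- s′)))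
          refl (seq z n) (seq w n) (seq s n) (seq s′ n) (seq s₁ n) (seq d′ n)))
      (≼-trans (peak-bound D) (≃⇒≽ (≃-by s′≃s₁ (2ℝ * (d + s)) (λ n → solve 5
        (λ z s s′ s₁ d → (z :+ two :* s′) :* (d :+ s) :- (z :+ two :* s₁) :* (d :+ s)
          := two :* (d :+ s) :* (s′ :- s₁))
        refl (seq z n) (seq s n) (seq s′ n) (seq s₁ n) (seq d n)))))

    -- The numerator is linear and the denominator convex in s, so the ratio is
    -- quasi-concave and hence increasing up to its maximum s₁.
    ratio-before-peak : ∀ {s s′ d d′} → 0ℝ ≼ s → s ≼ s′ → s′ ≼ s₁ → IsDist z u s d → IsDist z u s′ d′ →
      (z + 2ℝ * s) * (d′ + s′) ≼ (z + 2ℝ * s′) * (d + s)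
    ratio-before-peak {s} {s′} {d} {d′} 0≼s s≼s′ s′≼s₁ D D′ = ≼-by-cases s′ s
      -- For s = s′ the factor s₁ - s used in the other case may vanish; here equality of the two
      -- distances suffices.
      (λ s′≼s → let s′≃s = antisym s′≼s s≼s′ in ≼-trans
        (≼-by {y = (z + 2ℝ * s) * (d + s′)} (0≼* 0≼z+2s (≼⇒0≼- (dist-mono s′≃s D′ D))) (λ n → solve 5
          (λ z s s′ d d′ → (z :+ two :* s) :* (d :+ s′) :- (z :+ two :* s) :* (d′ :+ s′)
            := (z :+ (s :+ s)) :* (d :- d′))
          refl (seq z n) (seq s n) (seq s′ n) (seq d n) (seq d′ n)))
        (≃⇒≼ (≃-by s′≃s (z - 2ℝ * d) (λ n → solve 4
          (λ z s s′ d → (z :+ two :* s) :* (d :+ s′) :- (z :+ two :* s′) :* (d :+ s)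
            := (z :- two :* d) :* (s′ :- s))
          refl (seq z n) (seq s n) (seq s′ n) (seq d n)))))
      -- After multiplication by s₁ - s > 0, the difference is s′ - s times `peak-bound` plus z + 2s
      -- times the convexity inequality between s and s₁.
      (λ s≺s′ → *-cancelˡ-≼ (≺⇒0≺- (≺-≼-trans s≺s′ s′≼s₁))
        (≼-by (0≼+ (0≼* (≼⇒0≼- s≼s′) (≼⇒0≼- (peak-bound D)))
                   (0≼* 0≼z+2s (≼⇒0≼- (dist-convex s≼s′ s′≼s₁ D D′ peak-dist))))
          (λ n → solve 7 (λ z w s s′ s₁ d d′ →
            (s₁ :- s) :* ((z :+ two :* s′) :* (d :+ s)) :- (s₁ :- s) :* ((z :+ two :* s) :* (d′ :+ s′))
            := (s′ :- s) :* ((z :+ two :* s₁) :* (d :+ s) :- (z :+ two :* s) :* (w :+ z))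
              :+ (z :+ (s :+ s)) :* ((s₁ :- s′) :* d :+ (s′ :- s) :* (w :+ z :- s₁) :- (s₁ :- s) :* d′))
            refl (seq z n) (seq w n) (seq s n) (seq s′ n) (seq s₁ n) (seq d n) (seq d′ n))))
      where
      0≼z+2s : 0ℝ ≼ z + (s + s)
      0≼z+2s = 0≼+ 0≼z (0≼+ 0≼s 0≼s)

-- Both cases of the definition of t₁ say 2(w + z)(1 − t₁) = z(w + 2z): for
-- x ≠ 1 the common factor x − 1 cancels since w² − z² = z(x − 1).
peak-equation-x≠1 : ∀ {x y z w t₁} → x # 1ℝ → z ² ≃ (x - 1ℝ) ² + y ² → w ² ≃ z * z + z * (x - 1ℝ) →
  2ℝ * (x - 1ℝ) * t₁ ≃ x ² + y ² + z * (1ℝ - x) - 1ℝ - z * w →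
  2ℝ * (w + z) * (1ℝ - t₁) ≃ z * (w + 2ℝ * z)
-- The sign of D is unknown, so the positive factor D² is cancelled. The equation for z² gives D - N
-- = z(u + w - z), and the one for w² gives (w + z)(u + w - z) = u(w + 2z).
peak-equation-x≠1 {x} {y} {z} {w} {t₁} x#1 z² w² D*t₁≃N = *-cancelˡ-≃ 0≺D² (≃-trans
  (≃-by {y = D * (2ℝ * (w + z) * (D - N))} D*t₁≃N (- (2ℝ * (D * (w + z)))) (λ n → solve 5
    (λ D N w z t → D :* D :* (two :* (w :+ z) :* (con 1ℚ :- t)) :- D :* (two :* (w :+ z) :* (D :- N))
      := :- (two :* (D :* (w :+ z))) :* (D :* t :- N))
    refl (seq D n) (seq N n) (seq w n) (seq z n) (seq t₁ n)))
  (≃-trans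
    (≃-by {y = D * (2ℝ * (w + z) * (z * (u + w - z)))} z² (D * (2ℝ * (w + z))) (λ n → solve 4
      (λ x y z w → let
        u = x :- con 1ℚ
        D = two :* u
        N = x :* x :+ y :* y :+ z :* (con 1ℚ :- x) :- con 1ℚ :- z :* w
        in D :* (two :* (w :+ z) :* (D :- N)) :- D :* (two :* (w :+ z) :* (z :* (u :+ w :- z)))
          := D :* (two :* (w :+ z)) :* (z :* z :- (u :* u :+ y :* y)))
      refl (seq x n) (seq y n) (seq z n) (seq w n)))
    (≃-by w² (D * (2ℝ * z)) (λ n → solve 3
      (λ u z w → let D = two :* u in
        D :* (two :* (w :+ z) :* (z :* (u :+ w :- z))) :- D :* D :* (z :* (w :+ two :* z))
          := D :* (two :* z) :* (w :* w :- (z :* z :+ z :* u)))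
      refl (seq u n) (seq z n) (seq w n)))))
  where
  u D N : ℝ
  u = x - 1ℝ
  D = 2ℝ * u
  N = x ² + y ² + z * (1ℝ - x) - 1ℝ - z * w
  0≺D² : 0ℝ ≺ D ²
  0≺D² = #0⇒0≺² D (2[x-1]#0 x x#1)

peak-equation-x=1 : ∀ {x y z w t₁} → x ≃ 1ℝ → 0ℝ ≼ y → 0ℝ ≼ z → 0ℝ ≼ w →
  z ² ≃ (x - 1ℝ) ² + y ² → w ² ≃ z * z + z * (x - 1ℝ) → t₁ ≃ 1ℝ - ¾ * y →
  2ℝ * (w + z) * (1ℝ - t₁) ≃ z * (w + 2ℝ * z)
-- Here u = 0 forces y = z = w, as nonnegative reals with equal squares, and both sides become 3z².
peak-equation-x=1 {x} {y} {z} {w} {t₁} x≃1 0≼y 0≼z 0≼w z² w² t₁-eq = ≃-trans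
  (≃-by {y = 2ℝ * (w + z) * (¾ * y)} t₁-eq (- (2ℝ * (w + z))) (λ n → solve 4
    (λ w z y t → two :* (w :+ z) :* (con 1ℚ :- t) :- two :* (w :+ z) :* (con (+ 3 ℚ./ 4) :* y)
      := :- (two :* (w :+ z)) :* (t :- (con 1ℚ :- con (+ 3 ℚ./ 4) :* y)))
    refl (seq w n) (seq z n) (seq y n) (seq t₁ n)))
  (≃-trans
    (≃-by {y = 2ℝ * (w + z) * (¾ * z)} y≃z (2ℝ * (w + z) * ¾) (λ n → solve 3
      (λ w z y → two :* (w :+ z) :* (con (+ 3 ℚ./ 4) :* y) :- two :* (w :+ z) :* (con (+ 3 ℚ./ 4) :* z)
        := two :* (w :+ z) :* con (+ 3 ℚ./ 4) :* (y :- z))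
      refl (seq w n) (seq z n) (seq y n)))
    (≃-by w≃z (fromℚ ½ * z) (λ n → solve 2
      (λ w z → two :* (w :+ z) :* (con (+ 3 ℚ./ 4) :* z) :- z :* (w :+ two :* z)
        := con ½ :* z :* (w :- z))
      refl (seq w n) (seq z n))))
  where
  z²≃y² : z ² ≃ y ²
  z²≃y² = ≃-trans z² (≃-by x≃1 (x - 1ℝ) (λ n → solve 2
    (λ x y → let u = x :- con 1ℚ in u :* u :+ y :* y :- y :* y := u :* u) refl (seq x n) (seq y n)))
  w²≃z² : w ² ≃ z ²
  w²≃z² = ≃-trans w² (≃-by x≃1 z (λ n → solve 2
    (λ x z → z :* z :+ z :* (x :- con 1ℚ) :- z :* z := z :* (x :- con 1ℚ)) refl (seq x n) (seq z n)))
  y≃z : y ≃ z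
  y≃z = antisym (²-cancel-≼ 0≼z (≃⇒≽ z²≃y²)) (²-cancel-≼ 0≼y (≃⇒≼ z²≃y²))
  w≃z : w ≃ z
  w≃z = antisym (²-cancel-≼ 0≼z (≃⇒≼ w²≃z²)) (²-cancel-≼ 0≼w (≃⇒≽ w²≃z²))

-- From the ratio in s to the competitive ratio

CR-mono : ∀ A x y s t → 0ℝ ≼ A x y s → 0ℝ ≼ A x y t → 1ℝ ≼ √ ((x - t) ² + y ²) + 1ℝ - t →
  A x y s * (√ ((x - t) ² + y ²) + 1ℝ - t) ≼ A x y t * (√ ((x - s) ² + y ²) + 1ℝ - s) →
  CR A x y s ≼ CR A x y t
CR-mono A x y s t 0≼As 0≼At 1≼q h = ÷-mono-≼ {A x y s} {A x y t} {Opt x y s} {Opt x y t}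
  (1⊔x#0 (√ ((x - s) ² + y ²) + 1ℝ - s)) (1⊔x#0 (√ ((x - t) ² + y ²) + 1ℝ - t))
  (0≺Opt s) (0≺Opt t)
  -- At `t` the maximum in `Opt` is attained by its second entry; at `s` it is only bounded below by
  -- that entry, which is the direction needed.
  (≼-trans (*-monoʳ-≼ 0≼As (⊔-lub 1≼q ≼-refl)) (≼-trans h (*-monoʳ-≼ 0≼At y≼x⊔y)))
  where
  0≺Opt : ∀ t → 0ℝ ≺ Opt x y t
  0≺Opt t = ≺-≼-trans 0≺1 (x≼x⊔y {1ℝ} {√ ((x - t) ² + y ²) + 1ℝ - t})

module _ (x y : ℝ) where

  private
    z u w : ℝ
    z = z₁ x y
    u = x - 1ℝ
    w = √ (x * (x + z - 2ℝ) + y ² - z + 1ℝ)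

    0≼z : 0ℝ ≼ z
    0≼z = 0≼√ ((x - 1ℝ) ² + y ²)

    0≼w : 0ℝ ≼ w
    0≼w = 0≼√ (x * (x + z - 2ℝ) + y ² - z + 1ℝ)

    z² : z ² ≃ u ² + y ²
    z² = √-square (0≼+ (0≼² u) (0≼² y))

  u²≼z² : u ² ≼ z ²
  u²≼z² = ≼-trans (≼-by (0≼² y) (λ n → solve 2 (λ a b → a :+ b :- a := b) refl (seq (u ²) n) (seq (y ²) n))) (≃⇒≽ z²)

  u≼z₁ : u ≼ z
  u≼z₁ = ²-cancel-≼ 0≼z u²≼z²

  -z₁≼u : - z ≼ u
  -z₁≼u = ≼-by (≼⇒0≼- (²-cancel-≼ {a = - u} 0≼z (≼-trans
      (≗⇒≼ (λ n → solve 1 (λ u → :- u :* (:- u) := u :* u) refl (seq u n))) u²≼z²)))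
    (λ n → solve 2 (λ u z → u :- (:- z) := z :- (:- u)) refl (seq u n) (seq z n))

  -- The radicand regroups to (x - 1)² + y² + z(x - 1), and u ≥ -z makes z² + zu nonnegative.
  w² : w ² ≃ z * z + z * u
  w² = ≃-trans (√-square (≼-trans 0≼z²+zu (≃⇒≽ radicand))) radicand
    where
    radicand : x * (x + z - 2ℝ) + y ² - z + 1ℝ ≃ z * z + z * u
    radicand = ≃-by z² (- 1ℝ) (λ n → solve 3
      (λ x y z → let u = x :- con 1ℚ in
        x :* (x :+ z :- two) :+ y :* y :- z :+ con 1ℚ :- (z :* z :+ z :* u)
          := :- con 1ℚ :* (z :* z :- (u :* u :+ y :* y)))
      refl (seq x n) (seq y n) (seq z n))
    0≼z²+zu : 0ℝ ≼ z * z + z * u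
    0≼z²+zu = ≼-by (0≼* 0≼z (≼⇒0≼- -z₁≼u)) (λ n → solve 2
      (λ z u → z :* z :+ z :* u :- con 0ℚ := z :* (u :- (:- z))) refl (seq z n) (seq u n))

  -- Since x - t = u + (1 - t), expanding the square and substituting z² for u² + y² gives `dist²`.
  √-isDist : ∀ t → IsDist z u (1ℝ - t) (√ ((x - t) ² + y ²))
  √-isDist t = isDist (0≼√ ((x - t) ² + y ²)) (≃-trans (√-square (0≼+ (0≼² (x - t)) (0≼² y)))
    (≃-by z² (- 1ℝ) (λ n → solve 4
      (λ x y z t → let u = x :- con 1ℚ in
        (x :- t) :* (x :- t) :+ y :* y :- dist²′ z u (con 1ℚ :- t)
          := :- con 1ℚ :* (z :* z :- (u :* u :+ y :* y)))
      refl (seq x n) (seq y n) (seq z n) (seq t n))))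

  module _ {t₁ : ℝ} (is-t₁ : Is-t₁ x y t₁) where

    -- Whether x = 1 is undecidable, but an equality of reals may be proved by trichotomy, and each
    -- branch activates one field of `Is-t₁`.
    peak-equation : 0ℝ ≼ y → 2ℝ * (w + z) * (1ℝ - t₁) ≃ z * (w + 2ℝ * z)
    peak-equation 0≼y = ≃-by-cases x 1ℝ
      (λ x≼1 → ≃-by-cases 1ℝ x
        (λ 1≼x → let x≃1 = antisym x≼1 1≼x in
          peak-equation-x=1 x≃1 0≼y 0≼z 0≼w z² w² (≈⇒≃ (Is-t₁.x=1 is-t₁ (≃⇒≈ x≃1))))
        (λ x≺1 → apart (inj₁ (≺⇒< x≺1))))
      (λ 1≺x → apart (inj₂ (≺⇒< 1≺x)))
      where
      apart : x # 1ℝ → 2ℝ * (w + z) * (1ℝ - t₁) ≃ z * (w + 2ℝ * z)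
      apart x#1 = peak-equation-x≠1 {y = y} x#1 z² w²
        (÷-cancel {t₁-numerator x y} (2[x-1]#0 x x#1) (≈⇒≃ (Is-t₁.x≠1 is-t₁ x#1)))

    module _ (0≼y : 0ℝ ≼ y) (1≼z : 1ℝ ≼ z) where

      private
        module P = Peak -z₁≼u u≼z₁ (≺-≼-trans 0≺1 1≼z) 0≼w w² (peak-equation 0≼y)

        t* : ℝ
        t* = t₁ ⊔ 0ℝ

        1-anti : ∀ {s t} → s ≼ t → 1ℝ - t ≼ 1ℝ - s
        1-anti {s} {t} s≼t = ≼-by (≼⇒0≼- s≼t) (λ n → solve 2
          (λ s t → con 1ℚ :- s :- (con 1ℚ :- t) := t :- s) refl (seq s n) (seq t n))

      t₁⊔0≼1 : t* ≼ 1ℝ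
      -- The bound t₁ ≤ 1 is 0 ≤ s₁ for s₁ = 1 - t₁.
      t₁⊔0≼1 = ⊔-lub (≼-by P.0≼s₁ (λ _ → refl)) (≺⇒≼ 0≺1)

      private
        dist : ℝ → ℝ
        dist t = √ ((x - t) ² + y ²)

        ratio-max : ∀ t → 0ℝ ≼ t → t ≼ 1ℝ →
          (z + 2ℝ * (1ℝ - t)) * (dist t* + (1ℝ - t*)) ≼ (z + 2ℝ * (1ℝ - t*)) * (dist t + (1ℝ - t))
        -- If t₁ ≥ 0, then 1 - t* is the peak s₁. Otherwise t* = 0, and 1 - t ≤ 1 - t* ≤ s₁ lies on
        -- the increasing side.
        ratio-max t 0≼t t≼1 = ≼-by-cases 0ℝ t₁
          (λ 0≼t₁ → P.ratio-at-peak (≼⇒0≼- t≼1)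
            (antisym (1-anti x≼x⊔y) (1-anti (⊔-lub ≼-refl 0≼t₁)))
            (√-isDist t) (√-isDist t*))
          (λ t₁≺0 → P.ratio-before-peak (≼⇒0≼- t≼1)
            (1-anti (≼-trans (⊔-lub (≺⇒≼ t₁≺0) ≼-refl) 0≼t)) (1-anti x≼x⊔y)
            (√-isDist t) (√-isDist t*))

        0≼A₁ : ∀ {t} → t ≼ 1ℝ → 0ℝ ≼ A₁ x y t
        0≼A₁ {t} t≼1 = ≼-trans (0≼+ 0≼z (0≼+ (≼⇒0≼- t≼1) (≼⇒0≼- t≼1))) (≗⇒≼ (λ n → solve 2
          (λ z s → z :+ (s :+ s) := z :+ two :* s) refl (seq z n) (seq (1ℝ - t) n)))

        regroup : ∀ t → dist t + (1ℝ - t) ≃ dist t + 1ℝ - t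
        regroup t = ≗⇒≃ (λ n → sym (ℚₚ.+-assoc (seq (dist t) n) 1ℚ (ℚ.- seq t n)))

      CR-max : ∀ t → 0ℝ ≼ t → t ≼ 1ℝ → CR A₁ x y t ≼ CR A₁ x y t*
      CR-max t 0≼t t≼1 = CR-mono A₁ x y t t*
        (0≼A₁ t≼1) (0≼A₁ t₁⊔0≼1)
        -- The triangle inequality gives 1 ≤ z ≤ d + s at t*, so the constant 1 in `Opt` is inactive
        -- there.
        (≼-trans 1≼z (≼-trans (triangle -z₁≼u u≼z₁ (≼⇒0≼- t₁⊔0≼1) (√-isDist t*)) (≃⇒≼ (regroup t*))))
        (≼-trans (*-monoʳ-≼ (0≼A₁ t≼1) (≃⇒≽ (regroup t*)))
          (≼-trans (ratio-max t 0≼t t≼1) (*-monoʳ-≼ (0≼A₁ t₁⊔0≼1) (≃⇒≼ (regroup t)))))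

theorem2 : (x y : ℝ) → 0ℝ ≤ y → 1ℝ ≤ z₁ x y →
    (t₁ : ℝ) → Is-t₁ x y t₁ →
    IsCompetitiveRatio A₁ x y (CR A₁ x y (t₁ ⊔ 0ℝ))
theorem2 x y 0≤y 1≤z t₁ is-t₁ = upper , least
  where
  upper : ∀ v → (∃ λ t → 0ℝ ≤ t × t ≤ 1ℝ × v ≈ CR A₁ x y t) → v ≤ CR A₁ x y (t₁ ⊔ 0ℝ)
  upper v (t , 0≤t , t≤1 , v≈CR) =
    ≼⇒≤ (≼-trans (≃⇒≼ (≈⇒≃ {v} {CR A₁ x y t} v≈CR)) (CR-max x y is-t₁ (le 0≤y) (le 1≤z) t (le 0≤t) (le t≤1)))
  least : ∀ b → (∀ v → (∃ λ t → 0ℝ ≤ t × t ≤ 1ℝ × v ≈ CR A₁ x y t) → v ≤ b) → CR A₁ x y (t₁ ⊔ 0ℝ) ≤ b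
  -- The supremum is attained at `t₁ ⊔ 0ℝ`, so every upper bound dominates this value.
  least b bound = bound (CR A₁ x y (t₁ ⊔ 0ℝ))
    (t₁ ⊔ 0ℝ , ≼⇒≤ (y≼x⊔y {t₁} {0ℝ}) , ≼⇒≤ (t₁⊔0≼1 x y is-t₁ (le 0≤y) (le 1≤z)) , ≈-refl (CR A₁ x y (t₁ ⊔ 0ℝ)))
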